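{- Let $\lambda_2,\lambda_3$ be real numbers with $0 < \lambda_2 \leq \lambda_3$. Then $\{0, \lambda_2, \lambda_3\}$ (as a multiset) is Laplacian realizable for the path $P_3$ on three vertices if and only if $\lambda_3 \geq 3\lambda_2$.
   Context: For a finite simple graph $G$ on $n$ vertices, $\mathcal{S}_L(G)$ denotes the set of $n\times n$ real symmetric matrices $A=[a_{i,j}]$ such that $a_{i,j}<0$ if $\{i,j\}\in E(G)$, $a_{i,j}=0$ if $i\neq j$ and $\{i,j\}\notin E(G)$, and $a_{i,i}=-\sum_{k\neq i}a_{i,k}$ for all $i$. A multiset $\{0,\lambda_2,\ldots,\lambda_n\}$ of real numbers is Laplacian realizable for $G$ if there is $A\in\mathcal{S}_L(G)$ whose spectrum (multiset of eigenvalues) is $\{0,\lambda_2,\ldots,\lambda_n\}$. -}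

module Defs where

open import Algebra.Bundles.Raw using (RawRing)
import Algebra.Definitions.RawSemiring as RawSemiringDefs
open import Data.Bool.Base using (if_then_else_)
open import Data.Fin.Base using (Fin; zero; suc; toℕ)
import Data.Fin.Properties as Fin
open import Data.List.Base using (List; []; _∷_; map)
open import Data.Nat.Base as ℕ using (ℕ; zero; suc)
import Data.Nat.Properties as ℕ
open import Data.Product.Base using (∃-syntax; _×_; _,_; proj₁; proj₂)
open import Data.Rational.Base as ℚ using (ℚ; 0ℚ; 1ℚ; ½; Positive)
import Data.Rational.Properties as ℚ
open import Data.Rational.Solver using (module +-*-Solver)
open import Data.Vec.Functional using (Vector; removeAt)
open import Function.Base using (_∘_)
open import Level using (0ℓ)
open import Relation.Binary.Definitions using (Decidable; Irreflexive; Symmetric)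
open import Relation.Binary.PropositionalEquality
  using (_≡_; _≢_; refl; sym; trans; cong; cong₂; subst)
open import Relation.Nullary using (¬_; does)

------------------------------------------------------------------------
-- Real numbers: Cauchy sequences of rationals with a modulus of
-- convergence, considered up to _≈_. All operations are termwise.

Eventually : (ℕ → Set) → Set
Eventually P = ∃[ N ] ∀ n → N ℕ.≤ n → P n

Cauchy : (ℕ → ℚ) → Set
Cauchy x = ∀ ε → 0ℚ ℚ.< ε →
  ∃[ N ] ∀ m n → N ℕ.≤ m → N ℕ.≤ n → ℚ.∣ x m ℚ.- x n ∣ ℚ.< ε

record ℝ : Set where
  constructor mkℝ
  field
    seq    : ℕ → ℚ
    cauchy : Cauchy seq

open ℝ public

infix 4 _≈_ _<_ _≤_ _≥_

record _≈_ (x y : ℝ) : Set where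
  constructor mk≈
  field
    close : ∀ ε → 0ℚ ℚ.< ε →
      Eventually λ n → ℚ.∣ seq x n ℚ.- seq y n ∣ ℚ.< ε

record _<_ (x y : ℝ) : Set where
  constructor mk<
  field
    gap : ∃[ ε ] 0ℚ ℚ.< ε × Eventually λ n → seq x n ℚ.+ ε ℚ.≤ seq y n

record _≤_ (x y : ℝ) : Set where
  constructor mk≤
  field
    almost : ∀ ε → 0ℚ ℚ.< ε → Eventually λ n → seq x n ℚ.≤ seq y n ℚ.+ ε

_≥_ : ℝ → ℝ → Set
x ≥ y = y ≤ x

private
  const-cauchy : ∀ q → Cauchy (λ _ → q)
  const-cauchy q ε 0<ε = 0 , λ _ _ _ _ →
    subst (ℚ._< ε) (sym (cong ℚ.∣_∣ (ℚ.+-inverseʳ q))) 0<ε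

  half-pos : ∀ {ε} → 0ℚ ℚ.< ε → 0ℚ ℚ.< ½ ℚ.* ε
  half-pos 0<ε = ℚ.*-monoʳ-<-pos ½ 0<ε

  half+half : ∀ ε → ½ ℚ.* ε ℚ.+ ½ ℚ.* ε ≡ ε
  half+half = solve 1 (λ e → con ½ :* e :+ con ½ :* e := e) refl
    where open +-*-Solver

  +-cauchy : ∀ x y → Cauchy x → Cauchy y → Cauchy (λ n → x n ℚ.+ y n)
  +-cauchy x y cx cy ε 0<ε =
    N ℕ.⊔ M , λ m n N⊔M≤m N⊔M≤n → begin-strict
      ℚ.∣ (x m ℚ.+ y m) ℚ.- (x n ℚ.+ y n) ∣
        ≡⟨ cong ℚ.∣_∣ (regroup (x m) (y m) (x n) (y n)) ⟩
      ℚ.∣ (x m ℚ.- x n) ℚ.+ (y m ℚ.- y n) ∣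
        ≤⟨ ℚ.∣p+q∣≤∣p∣+∣q∣ (x m ℚ.- x n) (y m ℚ.- y n) ⟩
      ℚ.∣ x m ℚ.- x n ∣ ℚ.+ ℚ.∣ y m ℚ.- y n ∣
        <⟨ ℚ.+-mono-<
             (hx m n (ℕ.m⊔n≤o⇒m≤o N M N⊔M≤m) (ℕ.m⊔n≤o⇒m≤o N M N⊔M≤n))
             (hy m n (ℕ.m⊔n≤o⇒n≤o N M N⊔M≤m) (ℕ.m⊔n≤o⇒n≤o N M N⊔M≤n)) ⟩
      ½ ℚ.* ε ℚ.+ ½ ℚ.* ε
        ≡⟨ half+half ε ⟩
      ε ∎
    where
    open ℚ.≤-Reasoning
    N = proj₁ (cx (½ ℚ.* ε) (half-pos 0<ε))
    M = proj₁ (cy (½ ℚ.* ε) (half-pos 0<ε))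
    hx = proj₂ (cx (½ ℚ.* ε) (half-pos 0<ε))
    hy = proj₂ (cy (½ ℚ.* ε) (half-pos 0<ε))
    regroup : ∀ a b c d →
      (a ℚ.+ b) ℚ.- (c ℚ.+ d) ≡ (a ℚ.- c) ℚ.+ (b ℚ.- d)
    regroup = solve 4 (λ a b c d →
      (a :+ b) :- (c :+ d) := (a :- c) :+ (b :- d)) refl
      where open +-*-Solver

  neg-cauchy : ∀ x → Cauchy x → Cauchy (λ n → ℚ.- x n)
  neg-cauchy x cx ε 0<ε = proj₁ (cx ε 0<ε) , λ m n N≤m N≤n →
    subst (ℚ._< ε)
      (sym (trans (cong ℚ.∣_∣ (regroup (x m) (x n)))
                  (ℚ.∣-p∣≡∣p∣ (x m ℚ.- x n))))
      (proj₂ (cx ε 0<ε) m n N≤m N≤n)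
    where
    regroup : ∀ a b → (ℚ.- a) ℚ.- (ℚ.- b) ≡ ℚ.- (a ℚ.- b)
    regroup = solve 2 (λ a b → (:- a) :- (:- b) := :- (a :- b)) refl
      where open +-*-Solver

  cauchy-bounded : ∀ x → Cauchy x →
    ∃[ B ] Positive B × Eventually λ n → ℚ.∣ x n ∣ ℚ.≤ B
  cauchy-bounded x cx = ℚ.∣ x N ∣ ℚ.+ 1ℚ
    , ℚ.nonNeg+pos⇒pos ℚ.∣ x N ∣ {{ℚ.∣-∣-nonNeg (x N)}} 1ℚ
    , N , λ n N≤n → begin
      ℚ.∣ x n ∣
        ≡⟨ cong ℚ.∣_∣ (regroup (x n) (x N)) ⟩
      ℚ.∣ x N ℚ.+ (x n ℚ.- x N) ∣
        ≤⟨ ℚ.∣p+q∣≤∣p∣+∣q∣ (x N) (x n ℚ.- x N) ⟩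
      ℚ.∣ x N ∣ ℚ.+ ℚ.∣ x n ℚ.- x N ∣
        ≤⟨ ℚ.+-monoʳ-≤ ℚ.∣ x N ∣ (ℚ.<⇒≤ (proj₂ c1 n N N≤n ℕ.≤-refl)) ⟩
      ℚ.∣ x N ∣ ℚ.+ 1ℚ ∎
    where
    open ℚ.≤-Reasoning
    c1 = cx 1ℚ (ℚ.positive⁻¹ 1ℚ)
    N = proj₁ c1
    regroup : ∀ a b → a ≡ b ℚ.+ (a ℚ.- b)
    regroup = solve 2 (λ a b → a := b :+ (a :- b)) refl
      where open +-*-Solver

  scale : ∀ B → Positive B → ∀ ε → 0ℚ ℚ.< ε →
    ∃[ δ ] 0ℚ ℚ.< δ × B ℚ.* δ ≡ ε
  scale B posB ε 0<ε = B⁻¹ ℚ.* ε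
    , subst (ℚ._< B⁻¹ ℚ.* ε) (ℚ.*-zeroʳ B⁻¹)
        (ℚ.*-monoʳ-<-pos B⁻¹ {{ℚ.1/pos⇒pos B {{posB}}}} 0<ε)
    , trans (sym (ℚ.*-assoc B B⁻¹ ε))
        (trans (cong (ℚ._* ε) (ℚ.*-inverseʳ B {{nz}})) (ℚ.*-identityˡ ε))
    where
    nz = ℚ.pos⇒nonZero B {{posB}}
    B⁻¹ = (ℚ.1/ B) {{nz}}

  *-cauchy : ∀ x y → Cauchy x → Cauchy y → Cauchy (λ n → x n ℚ.* y n)
  *-cauchy x y cx cy ε 0<ε = N , λ m n N≤m N≤n → begin-strict
      ℚ.∣ x m ℚ.* y m ℚ.- x n ℚ.* y n ∣
        ≡⟨ cong ℚ.∣_∣ (regroup (x m) (y m) (x n) (y n)) ⟩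
      ℚ.∣ x m ℚ.* (y m ℚ.- y n) ℚ.+ y n ℚ.* (x m ℚ.- x n) ∣
        ≤⟨ ℚ.∣p+q∣≤∣p∣+∣q∣ (x m ℚ.* (y m ℚ.- y n)) (y n ℚ.* (x m ℚ.- x n)) ⟩
      ℚ.∣ x m ℚ.* (y m ℚ.- y n) ∣ ℚ.+ ℚ.∣ y n ℚ.* (x m ℚ.- x n) ∣
        <⟨ ℚ.+-mono-<
             (bound B posB (x m) (y m ℚ.- y n)
               (proj₂ (proj₂ (proj₂ bx)) m (N₁≤ N≤m))
               (proj₂ cyδ m n (N₄≤ N≤m) (N₄≤ N≤n)))
             (bound C posC (y n) (x m ℚ.- x n)
               (proj₂ (proj₂ (proj₂ by)) n (N₂≤ N≤n))
               (proj₂ cxδ m n (N₃≤ N≤m) (N₃≤ N≤n))) ⟩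
      B ℚ.* δ ℚ.+ C ℚ.* δ
        ≡⟨ sym (ℚ.*-distribʳ-+ δ B C) ⟩
      (B ℚ.+ C) ℚ.* δ
        ≡⟨ proj₂ (proj₂ tol) ⟩
      ε ∎
    where
    open ℚ.≤-Reasoning
    bx = cauchy-bounded x cx
    by = cauchy-bounded y cy
    B = proj₁ bx
    C = proj₁ by
    posB = proj₁ (proj₂ bx)
    posC = proj₁ (proj₂ by)
    tol = scale (B ℚ.+ C) (ℚ.pos+pos⇒pos B {{posB}} C {{posC}}) ε 0<ε
    δ = proj₁ tol
    cxδ = cx δ (proj₁ (proj₂ tol))
    cyδ = cy δ (proj₁ (proj₂ tol))
    N₁ = proj₁ (proj₂ (proj₂ bx))
    N₂ = proj₁ (proj₂ (proj₂ by))
    N₃ = proj₁ cxδ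
    N₄ = proj₁ cyδ
    N = (N₁ ℕ.⊔ N₂) ℕ.⊔ (N₃ ℕ.⊔ N₄)
    N₁≤ : ∀ {k} → N ℕ.≤ k → N₁ ℕ.≤ k
    N₁≤ = ℕ.m⊔n≤o⇒m≤o N₁ N₂ ∘ ℕ.m⊔n≤o⇒m≤o (N₁ ℕ.⊔ N₂) (N₃ ℕ.⊔ N₄)
    N₂≤ : ∀ {k} → N ℕ.≤ k → N₂ ℕ.≤ k
    N₂≤ = ℕ.m⊔n≤o⇒n≤o N₁ N₂ ∘ ℕ.m⊔n≤o⇒m≤o (N₁ ℕ.⊔ N₂) (N₃ ℕ.⊔ N₄)
    N₃≤ : ∀ {k} → N ℕ.≤ k → N₃ ℕ.≤ k
    N₃≤ = ℕ.m⊔n≤o⇒m≤o N₃ N₄ ∘ ℕ.m⊔n≤o⇒n≤o (N₁ ℕ.⊔ N₂) (N₃ ℕ.⊔ N₄)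
    N₄≤ : ∀ {k} → N ℕ.≤ k → N₄ ℕ.≤ k
    N₄≤ = ℕ.m⊔n≤o⇒n≤o N₃ N₄ ∘ ℕ.m⊔n≤o⇒n≤o (N₁ ℕ.⊔ N₂) (N₃ ℕ.⊔ N₄)
    regroup : ∀ a b c d →
      a ℚ.* b ℚ.- c ℚ.* d ≡ a ℚ.* (b ℚ.- d) ℚ.+ d ℚ.* (a ℚ.- c)
    regroup = solve 4 (λ a b c d →
      a :* b :- c :* d := a :* (b :- d) :+ d :* (a :- c)) refl
      where open +-*-Solver
    bound : ∀ D → Positive D → ∀ a d →
      ℚ.∣ a ∣ ℚ.≤ D → ℚ.∣ d ∣ ℚ.< δ → ℚ.∣ a ℚ.* d ∣ ℚ.< D ℚ.* δ
    bound D posD a d ∣a∣≤D ∣d∣<δ = begin-strict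
      ℚ.∣ a ℚ.* d ∣
        ≡⟨ ℚ.∣p*q∣≡∣p∣*∣q∣ a d ⟩
      ℚ.∣ a ∣ ℚ.* ℚ.∣ d ∣
        ≤⟨ ℚ.*-monoʳ-≤-nonNeg ℚ.∣ d ∣ {{ℚ.∣-∣-nonNeg d}} ∣a∣≤D ⟩
      D ℚ.* ℚ.∣ d ∣
        <⟨ ℚ.*-monoʳ-<-pos D {{posD}} ∣d∣<δ ⟩
      D ℚ.* δ ∎

infixl 6 _+_
infixl 7 _*_
infix  8 -_

-- Opaque to keep normal forms small: the moduli, and ℚ's arithmetic even on
-- neutral terms, unfold to huge expressions.
opaque
  fromℚ : ℚ → ℝ
  fromℚ q = mkℝ (λ _ → q) (const-cauchy q)

  _+_ : ℝ → ℝ → ℝ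
  x + y = mkℝ (λ n → seq x n ℚ.+ seq y n)
    (+-cauchy (seq x) (seq y) (cauchy x) (cauchy y))

  -_ : ℝ → ℝ
  - x = mkℝ (λ n → ℚ.- seq x n) (neg-cauchy (seq x) (cauchy x))

  _*_ : ℝ → ℝ → ℝ
  x * y = mkℝ (λ n → seq x n ℚ.* seq y n)
    (*-cauchy (seq x) (seq y) (cauchy x) (cauchy y))

0ℝ 1ℝ : ℝ
0ℝ = fromℚ 0ℚ
1ℝ = fromℚ 1ℚ

ℝ-rawRing : RawRing 0ℓ 0ℓ
ℝ-rawRing = record
  { Carrier = ℝ ; _≈_ = _≈_ ; _+_ = _+_ ; _*_ = _*_ ; -_ = -_
  ; 0# = 0ℝ ; 1# = 1ℝ }

------------------------------------------------------------------------
-- Polynomials, determinants and characteristic polynomials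

Matrix : ∀ {a} → Set a → ℕ → Set a
Matrix A n = Fin n → Fin n → A

module Polynomial {c ℓ} (R : RawRing c ℓ) where
  open RawRing R renaming (_≈_ to _≈′_; _+_ to _+′_; _*_ to _*′_; -_ to -′_)

  -- Coefficients in order of increasing degree; trailing zeros are
  -- allowed, and _≈ₚ_ ignores them.
  Poly : Set c
  Poly = List Carrier

  coeff : Poly → ℕ → Carrier
  coeff []      _       = 0#
  coeff (a ∷ p) zero    = a
  coeff (a ∷ p) (suc k) = coeff p k

  _≈ₚ_ : Poly → Poly → Set ℓ
  p ≈ₚ q = ∀ k → coeff p k ≈′ coeff q k

  _+ₚ_ : Poly → Poly → Poly
  []      +ₚ q       = q
  (a ∷ p) +ₚ []      = a ∷ p
  (a ∷ p) +ₚ (b ∷ q) = (a +′ b) ∷ (p +ₚ q)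

  _*ₚ_ : Poly → Poly → Poly
  []      *ₚ q = []
  (a ∷ p) *ₚ q = map (a *′_) q +ₚ (0# ∷ (p *ₚ q))

  const : Carrier → Poly
  const a = a ∷ []

  X : Poly
  X = 0# ∷ 1# ∷ []

  rawRing : RawRing c ℓ
  rawRing = record
    { Carrier = Poly ; _≈_ = _≈ₚ_ ; _+_ = _+ₚ_ ; _*_ = _*ₚ_ ; -_ = map -′_
    ; 0# = [] ; 1# = const 1# }

module Determinant {c ℓ} (R : RawRing c ℓ) where
  open RawRing R renaming (_*_ to _*′_; -_ to -′_) hiding (_≈_; _+_)
  open RawSemiringDefs rawSemiring using (sum; _^_)

  -- Cofactor expansion along the first row.
  det : ∀ {n} → Matrix Carrier n → Carrier
  det {zero}  A = 1#
  det {suc n} A = sum λ j →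
    (-′ 1#) ^ toℕ j *′ (A zero j *′ det (λ i → removeAt (A (suc i)) j))

module CharacteristicPolynomial {c ℓ} (R : RawRing c ℓ) where
  open RawRing R using (Carrier)
  open Polynomial R
  open RawRing rawRing using (rawSemiring; 0#)
    renaming (_+_ to _+′_; -_ to -′_)
  open RawSemiringDefs rawSemiring using (product)

  charPoly : ∀ {n} → Matrix Carrier n → Poly
  charPoly A = Determinant.det rawRing λ i j →
    (if does (i Fin.≟ j) then X else 0#) +′ -′ const (A i j)

  rootProduct : ∀ {n} → Vector Carrier n → Poly
  rootProduct Λ = product λ i → X +′ -′ const (Λ i)

open Polynomial ℝ-rawRing public using (Poly; _≈ₚ_)
open CharacteristicPolynomial ℝ-rawRing public using (charPoly; rootProduct)
open RawSemiringDefs (RawRing.rawSemiring ℝ-rawRing) public using (sum)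

-- Λ lists the eigenvalues of A with (algebraic) multiplicity, that is,
-- det (X·I − A) = ∏ᵢ (X − Λᵢ) in ℝ[X]. The order of Λ is immaterial, so Λ
-- stands for a multiset.
HasSpectrum : ∀ {n} → Matrix ℝ n → Vector ℝ n → Set
HasSpectrum A Λ = charPoly A ≈ₚ rootProduct Λ

------------------------------------------------------------------------
-- Graphs and Laplacian realizability

record SimpleGraph (n : ℕ) : Set₁ where
  field
    Adj    : Fin n → Fin n → Set
    adj?   : Decidable Adj
    symm   : Symmetric Adj
    irrefl : Irreflexive _≡_ Adj

path : ∀ n → SimpleGraph n
path n = record
  { Adj    = λ i j → ℕ.∣ toℕ i - toℕ j ∣ ≡ 1
  ; adj?   = λ i j → ℕ.∣ toℕ i - toℕ j ∣ ℕ.≟ 1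
  ; symm   = λ {i} {j} e → trans (ℕ.∣-∣-comm (toℕ j) (toℕ i)) e
  ; irrefl = λ { {i} refl e → ℕ.0≢1+n (trans (sym (ℕ.∣n-n∣≡0 (toℕ i))) e) }
  }

-- The set 𝒮_L(G) of weighted Laplacians of G, as a predicate on matrices.
record 𝒮ᴸ {n} (G : SimpleGraph n) (A : Matrix ℝ n) : Set where
  open SimpleGraph G
  field
    symmetric   : ∀ i j → A i j ≈ A j i
    adjacent    : ∀ i j → Adj i j → A i j < 0ℝ
    nonadjacent : ∀ i j → i ≢ j → ¬ Adj i j → A i j ≈ 0ℝ
    diagonal    : ∀ i →
      A i i ≈ - sum (λ k → if does (k Fin.≟ i) then 0ℝ else A i k)

LaplacianRealizable : ∀ {n} → SimpleGraph n → Vector ℝ n → Set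
LaplacianRealizable {n} G Λ = ∃[ A ] 𝒮ᴸ {n} G A × HasSpectrum A Λ

{-# OPTIONS --safe #-}
-- A weighted Laplacian of P₃ with edge weights a, b > 0 has characteristic
-- polynomial X³ − 2(a + b)X² + 3abX, so {0, y, z} is realizable iff there are
-- positive a, b with a + b = (y + z)/2 and ab = yz/3, that is, iff the
-- quadratic t² − (y + z)/2 t + yz/3 has a nonnegative discriminant. Twelve times
-- the discriminant is (z − 3y)(3z − y), and 3z − y > 0 because z ≥ y > 0.
-- Constructively, the square root of a Cauchy real is the sequence of rational
-- approximate roots of the truncations of its terms at 0.

module Submission where

open import Defs
open import Algebra.Bundles using (CommutativeRing)
open import Algebra.Bundles.Raw using (RawRing)
import Algebra.Consequences.Setoid
import Algebra.Definitions.RawMonoid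
import Algebra.Solver.Ring
import Algebra.Solver.Ring.AlmostCommutativeRing as ACR
open import Data.Empty using (⊥-elim)
open import Data.Fin.Base using (Fin; combine)
open import Data.Fin.Patterns using (0F; 1F; 2F)
open import Data.Integer using (+_)
import Data.Integer.Base as ℤ
import Data.Integer.Properties as ℤ
open import Data.List.Base as List using (List)
import Data.Maybe.Base as Maybe
open import Data.Nat.Base as ℕ using (ℕ; zero; suc)
import Data.Nat.Properties as ℕ
open import Data.Product.Base using (∃-syntax; _×_; _,_; proj₁; proj₂)
open import Data.Rational using (_/_)
open import Data.Rational.Base as ℚ using (ℚ; 0ℚ; 1ℚ; ½)
import Data.Rational.Properties as ℚ
import Data.Rational.Solver
import Data.Rational.Unnormalised.Base as ℚᵘ
import Data.Rational.Unnormalised.Properties as ℚᵘ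
open import Data.Sum.Base using (inj₁; inj₂)
import Data.Vec.Base as Vec
open import Data.Vec.Functional using (_∷_; [])
open import Function.Bundles using (_⇔_; mk⇔)
open import Level using (0ℓ)
open import Relation.Binary.Bundles using (Setoid)
open import Relation.Binary.Definitions using (WeaklyDecidable)
open import Relation.Binary.PropositionalEquality
  using (_≡_; refl; sym; trans; cong; cong₂; subst; subst₂)
import Relation.Binary.Reasoning.Setoid as SetoidReasoning
open import Relation.Nullary using (yes; no; contradiction)
open import Relation.Nullary.Decidable using (dec⇒maybe)

-- Rational numbers

open Algebra.Definitions.RawMonoid ℚ.+-0-rawMonoid using () renaming (_×_ to _×ℚ_)

-- The sign of a real cannot be decided, so no argument on reals may split on signs, and three steps
-- take their form from this. The forward direction cancels the strictly positive 3z - y from (z -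
-- 3y)(3z - y) ≥ 0 by an explicit estimate on the terms. In the converse the weights are s + r and s
-- - r with s = (y + z)/4; the second is positive because its product with the positive first one is
-- yz/3 > 0, so r is never compared with s. A product of nonnegative reals is nonnegative because it
-- is the square of a product of square roots. The constant 3 is the ratio z/y at equal weights,
-- where the discriminant vanishes: unit weights give the eigenvalues 0, 1, 3.

module ℚ-Solver = Data.Rational.Solver.+-*-Solver

1>0 : 0ℚ ℚ.< 1ℚ
1>0 = ℚ.positive⁻¹ 1ℚ

p<p+q : ∀ p {q} → 0ℚ ℚ.< q → p ℚ.< p ℚ.+ q
p<p+q p 0<q = subst (ℚ._< p ℚ.+ _) (ℚ.+-identityʳ p) (ℚ.+-monoʳ-< p 0<q)

p≤p+q : ∀ p {q} → 0ℚ ℚ.≤ q → p ℚ.≤ p ℚ.+ q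
p≤p+q p 0≤q = subst (ℚ._≤ p ℚ.+ _) (ℚ.+-identityʳ p) (ℚ.+-monoʳ-≤ p 0≤q)

+-pos : ∀ {p q} → 0ℚ ℚ.< p → 0ℚ ℚ.< q → 0ℚ ℚ.< p ℚ.+ q
+-pos {p} 0<p 0<q = ℚ.<-trans 0<p (p<p+q p 0<q)

*-pos : ∀ {p q} → 0ℚ ℚ.< p → 0ℚ ℚ.< q → 0ℚ ℚ.< p ℚ.* q
*-pos {p} {q} 0<p 0<q =
  subst (ℚ._< p ℚ.* q) (ℚ.*-zeroʳ p) (ℚ.*-monoʳ-<-pos p {{ℚ.positive 0<p}} 0<q)

*-nonNeg : ∀ {p q} → 0ℚ ℚ.≤ p → 0ℚ ℚ.≤ q → 0ℚ ℚ.≤ p ℚ.* q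
*-nonNeg {p} {q} 0≤p 0≤q = subst (ℚ._≤ p ℚ.* q) (ℚ.*-zeroʳ p)
  (ℚ.*-monoˡ-≤-nonNeg p {{ℚ.nonNegative 0≤p}} 0≤q)

square-nonNeg : ∀ p → 0ℚ ℚ.≤ p ℚ.* p
square-nonNeg p with ℚ.≤-total 0ℚ p
... | inj₁ 0≤p = *-nonNeg 0≤p 0≤p
... | inj₂ p≤0 = subst (0ℚ ℚ.≤_) (neg-square p) (*-nonNeg 0≤-p 0≤-p)
  where
  open ℚ-Solver
  0≤-p = ℚ.neg-antimono-≤ p≤0
  neg-square : ∀ p → (ℚ.- p) ℚ.* (ℚ.- p) ≡ p ℚ.* p
  neg-square = solve 1 (λ p → (:- p) :* (:- p) := p :* p) refl

square-mono-≤ : ∀ {p q} → 0ℚ ℚ.≤ p → p ℚ.≤ q → p ℚ.* p ℚ.≤ q ℚ.* q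
square-mono-≤ {p} {q} 0≤p p≤q = ℚ.≤-trans
  (ℚ.*-monoˡ-≤-nonNeg p {{ℚ.nonNegative 0≤p}} p≤q)
  (ℚ.*-monoʳ-≤-nonNeg q {{ℚ.nonNegative (ℚ.≤-trans 0≤p p≤q)}} p≤q)

halve : ∀ {ε} → 0ℚ ℚ.< ε → 0ℚ ℚ.< ½ ℚ.* ε
halve = *-pos (ℚ.positive⁻¹ ½)

½+½ : ∀ ε → ½ ℚ.* ε ℚ.+ ½ ℚ.* ε ≡ ε
½+½ = solve 1 (λ e → con ½ :* e :+ con ½ :* e := e) refl
  where open ℚ-Solver

*-cancel-pos : ∀ {b d} → 0ℚ ℚ.< b → 0ℚ ℚ.< b ℚ.* d → 0ℚ ℚ.< d
*-cancel-pos {b} {d} 0<b 0<bd = ℚ.*-cancelˡ-<-nonNeg b {{ℚ.nonNegative (ℚ.<⇒≤ 0<b)}}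
  (subst (ℚ._< b ℚ.* d) (sym (ℚ.*-zeroʳ b)) 0<bd)

opaque
  -- Division enters only through its defining equation; opacity keeps the reciprocal from unfolding
  -- in later goals.
  quotient : ∀ b → 0ℚ ℚ.< b → ∀ p → ∃[ d ] b ℚ.* d ≡ p
  quotient b 0<b p = b⁻¹ ℚ.* p ,
    trans (sym (ℚ.*-assoc b b⁻¹ p))
      (trans (cong (ℚ._* p) (ℚ.*-inverseʳ b {{nz}})) (ℚ.*-identityˡ p))
    where
    nz : ℚ.NonZero b
    nz = ℚ.pos⇒nonZero b {{ℚ.positive 0<b}}
    b⁻¹ : ℚ
    b⁻¹ = (ℚ.1/ b) {{nz}}

  pos-quotient : ∀ b → 0ℚ ℚ.< b → ∀ p → 0ℚ ℚ.< p → ∃[ d ] 0ℚ ℚ.< d × b ℚ.* d ≡ p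
  pos-quotient b 0<b p 0<p with d , bd≡p ← quotient b 0<b p =
    d , *-cancel-pos 0<b (subst (0ℚ ℚ.<_) (sym bd≡p) 0<p) , bd≡p

p<q+r⇒p-q<r : ∀ {p} q {r} → p ℚ.< q ℚ.+ r → p ℚ.- q ℚ.< r
p<q+r⇒p-q<r {p} q {r} p<q+r =
  subst (p ℚ.- q ℚ.<_) (cancel q r) (ℚ.+-monoˡ-< (ℚ.- q) p<q+r)
  where
  open ℚ-Solver
  cancel : ∀ q r → q ℚ.+ r ℚ.- q ≡ r
  cancel = solve 2 (λ q r → q :+ r :- q := r) refl

∣p-q∣<r : ∀ p q {r} → p ℚ.< q ℚ.+ r → q ℚ.< p ℚ.+ r → ℚ.∣ p ℚ.- q ∣ ℚ.< r
∣p-q∣<r p q p<q+r q<p+r with ℚ.∣p∣≡p∨∣p∣≡-p (p ℚ.- q)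
... | inj₁ eq = subst (ℚ._< _) (sym eq) (p<q+r⇒p-q<r q p<q+r)
... | inj₂ eq = subst (ℚ._< _) (trans (swap q p) (sym eq)) (p<q+r⇒p-q<r p q<p+r)
  where
  open ℚ-Solver
  swap : ∀ q p → q ℚ.- p ≡ ℚ.- (p ℚ.- q)
  swap = solve 2 (λ q p → q :- p := :- (p :- q)) refl

p≤∣p∣ : ∀ p → p ℚ.≤ ℚ.∣ p ∣
p≤∣p∣ p with ℚ.≤-total 0ℚ p
... | inj₁ 0≤p = ℚ.≤-reflexive (sym (ℚ.0≤p⇒∣p∣≡p 0≤p))
... | inj₂ p≤0 = ℚ.≤-trans p≤0 (ℚ.0≤∣p∣ p)

∣p-q∣≡∣q-p∣ : ∀ p q → ℚ.∣ p ℚ.- q ∣ ≡ ℚ.∣ q ℚ.- p ∣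
∣p-q∣≡∣q-p∣ p q = trans (cong ℚ.∣_∣ (swap p q)) (ℚ.∣-p∣≡∣p∣ (q ℚ.- p))
  where
  open ℚ-Solver
  swap : ∀ p q → p ℚ.- q ≡ ℚ.- (q ℚ.- p)
  swap = solve 2 (λ p q → p :- q := :- (q :- p)) refl

∣p-q∣<r⇒p<q+r : ∀ p q {r} → ℚ.∣ p ℚ.- q ∣ ℚ.< r → p ℚ.< q ℚ.+ r
∣p-q∣<r⇒p<q+r p q {r} lt = subst (ℚ._< q ℚ.+ r) (cancel p q)
  (ℚ.+-monoʳ-< q (ℚ.≤-<-trans (p≤∣p∣ (p ℚ.- q)) lt))
  where
  open ℚ-Solver
  cancel : ∀ p q → q ℚ.+ (p ℚ.- q) ≡ p
  cancel = solve 2 (λ p q → q :+ (p :- q) := p) refl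

-- The Archimedean property and rational approximate square roots

fromℕ : ℕ → ℚ
fromℕ n = n ×ℚ 1ℚ

-- Passing to unnormalised fractions avoids the reduction to lowest terms after each addition and
-- turns comparisons with `fromℕ n` into integer inequalities.
toℚᵘ-fromℕ : ∀ n → ℚ.toℚᵘ (fromℕ n) ℚᵘ.≃ ℚᵘ.mkℚᵘ (ℤ.+ n) 0
toℚᵘ-fromℕ zero    = ℚᵘ.≃-refl
toℚᵘ-fromℕ (suc n) = ℚᵘ.≃-trans (ℚ.toℚᵘ-homo-+ 1ℚ (fromℕ n))
  (ℚᵘ.≃-trans (ℚᵘ.+-congʳ (ℚ.toℚᵘ 1ℚ) (toℚᵘ-fromℕ n))
    (ℚᵘ.*≡* (cong (λ m → (ℤ.+ 1 ℤ.+ m) ℤ.* ℤ.+ 1) (ℤ.*-identityʳ (ℤ.+ n)))))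

-- The denominator is at least 1, so dropping it can only enlarge a nonnegative fraction; a negative
-- one lies below any natural number.
p≤fromℕ∣↥p∣ : ∀ p → p ℚ.≤ fromℕ ℤ.∣ ℚ.↥ p ∣
p≤fromℕ∣↥p∣ (ℚ.mkℚ i d-1 _) = ℚ.toℚᵘ-cancel-≤
  (ℚᵘ.≤-respʳ-≃ (ℚᵘ.≃-sym (toℚᵘ-fromℕ ℤ.∣ i ∣)) (ℚᵘ.*≤* (bound i)))
  where
  d = suc d-1
  bound : ∀ i → i ℤ.* ℤ.+ 1 ℤ.≤ ℤ.+ ℤ.∣ i ∣ ℤ.* ℤ.+ d
  bound (ℤ.+ n) = subst₂ ℤ._≤_ (sym (ℤ.*-identityʳ (ℤ.+ n))) (ℤ.pos-* n d)
    (ℤ.+≤+ (ℕ.m≤m*n n d))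
  bound (ℤ.-[1+ n ]) = subst (ℤ._≤ ℤ.+ suc n ℤ.* ℤ.+ d) (sym (ℤ.*-identityʳ ℤ.-[1+ n ]))
    ℤ.-≤+

archimedean : ∀ h → 0ℚ ℚ.< h → ∀ p → ∃[ n ] p ℚ.≤ fromℕ n ℚ.* h
archimedean h 0<h p with t , ht≡p ← quotient h 0<h p =
  ℤ.∣ ℚ.↥ t ∣ , subst (ℚ._≤ fromℕ ℤ.∣ ℚ.↥ t ∣ ℚ.* h) (trans (ℚ.*-comm t h) ht≡p)
    (ℚ.*-monoʳ-≤-nonNeg h {{ℚ.nonNegative (ℚ.<⇒≤ 0<h)}} (p≤fromℕ∣↥p∣ t))

fromℕ-nonNeg : ∀ n → 0ℚ ℚ.≤ fromℕ n
fromℕ-nonNeg zero    = ℚ.≤-refl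
fromℕ-nonNeg (suc n) = ℚ.+-mono-≤ (ℚ.<⇒≤ 1>0) (fromℕ-nonNeg n)

fromℕ-suc-pos : ∀ n → 0ℚ ℚ.< fromℕ (suc n)
fromℕ-suc-pos n = ℚ.+-mono-<-≤ 1>0 (fromℕ-nonNeg n)

fromℕ-mono : ∀ {m n} → m ℕ.≤ n → fromℕ m ℚ.≤ fromℕ n
fromℕ-mono {n = n} ℕ.z≤n = fromℕ-nonNeg n
fromℕ-mono (ℕ.s≤s m≤n)   = ℚ.+-monoʳ-≤ 1ℚ (fromℕ-mono m≤n)

-- The reciprocal of n + 1: the error allowed in the square of the n-th term of a square root.
δ : ℕ → ℚ
δ n = proj₁ (quotient (fromℕ (suc n)) (fromℕ-suc-pos n) 1ℚ)

δ-inverse : ∀ n → fromℕ (suc n) ℚ.* δ n ≡ 1ℚ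
δ-inverse n = proj₂ (quotient (fromℕ (suc n)) (fromℕ-suc-pos n) 1ℚ)

δ-pos : ∀ n → 0ℚ ℚ.< δ n
δ-pos n = *-cancel-pos (fromℕ-suc-pos n) (subst (0ℚ ℚ.<_) (sym (δ-inverse n)) 1>0)

δ-vanishing : ∀ ε → 0ℚ ℚ.< ε → Eventually λ n → δ n ℚ.≤ ε
δ-vanishing ε 0<ε with N , 1≤Nε ← archimedean ε 0<ε 1ℚ = N , λ n N≤n →
  ℚ.*-cancelˡ-≤-pos (fromℕ (suc n)) {{ℚ.positive (fromℕ-suc-pos n)}}
    (subst (ℚ._≤ fromℕ (suc n) ℚ.* ε) (sym (δ-inverse n))
      (ℚ.≤-trans 1≤Nε (ℚ.*-monoʳ-≤-nonNeg ε {{ℚ.nonNegative (ℚ.<⇒≤ 0<ε)}}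
        (fromℕ-mono (ℕ.m≤n⇒m≤1+n N≤n)))))

-- The largest multiple k h with (k h)² ≤ q is found by searching downwards from n h.
square-bracket : ∀ {q} h → 0ℚ ℚ.≤ q → ∀ n → q ℚ.< (fromℕ n ℚ.* h) ℚ.* (fromℕ n ℚ.* h) →
  ∃[ k ] (fromℕ k ℚ.* h) ℚ.* (fromℕ k ℚ.* h) ℚ.≤ q
    × q ℚ.< (fromℕ (suc k) ℚ.* h) ℚ.* (fromℕ (suc k) ℚ.* h)
square-bracket h 0≤q zero q<0 =
  ⊥-elim (ℚ.<-irrefl refl (ℚ.≤-<-trans 0≤q
    (subst (_ ℚ.<_) (cong₂ ℚ._*_ (ℚ.*-zeroˡ h) (ℚ.*-zeroˡ h)) q<0)))
square-bracket {q} h 0≤q (suc n) q<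
  with q ℚ.<? (fromℕ n ℚ.* h) ℚ.* (fromℕ n ℚ.* h)
... | yes q<′ = square-bracket h 0≤q n q<′
... | no  q≮  = n , ℚ.≮⇒≥ q≮ , q<

opaque
  -- Among the multiples of a mesh h, the squares of neighbours r and r + h differ by (h + 2r)h. A
  -- mesh with dh = ε, where d bounds h + 2r for every r with r² ≤ q, makes this at most ε.
  approx-sqrt : ∀ {q} ε → 0ℚ ℚ.≤ q → 0ℚ ℚ.< ε →
    ∃[ r ] 0ℚ ℚ.≤ r × r ℚ.* r ℚ.≤ q × q ℚ.< r ℚ.* r ℚ.+ ε
  approx-sqrt {q} ε 0≤q 0<ε =
    r , 0≤r , r²≤q , ℚ.<-≤-trans q<[r+h]² step
    where
    open ℚ-Solver
    1+q : ℚ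
    1+q = 1ℚ ℚ.+ q
    0<1+q : 0ℚ ℚ.< 1+q
    0<1+q = ℚ.+-mono-<-≤ 1>0 0≤q
    -- The summands 1 and 1 + q bound h and 2r; the summand ε forces dh = ε ≤ d and hence h ≤ 1.
    d : ℚ
    d = 1ℚ ℚ.+ 1+q ℚ.+ ε
    0<d : 0ℚ ℚ.< d
    0<d = +-pos (+-pos 1>0 0<1+q) 0<ε
    step-size : ∃[ h ] 0ℚ ℚ.< h × d ℚ.* h ≡ ε
    step-size = pos-quotient d 0<d ε 0<ε
    h : ℚ
    h = proj₁ step-size
    0<h : 0ℚ ℚ.< h
    0<h = proj₁ (proj₂ step-size)
    dh≡ε : d ℚ.* h ≡ ε
    dh≡ε = proj₂ (proj₂ step-size)
    h≤1 : h ℚ.≤ 1ℚ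
    h≤1 = ℚ.*-cancelˡ-≤-pos d {{ℚ.positive 0<d}} (subst₂ ℚ._≤_ (sym dh≡ε) (sym (ℚ.*-identityʳ d))
      (subst (ℚ._≤ d) (ℚ.+-identityˡ ε) (ℚ.+-monoˡ-≤ ε (ℚ.<⇒≤ (+-pos 1>0 0<1+q)))))
    -- The downward search may start at any multiple beyond 1 + q, since (1 + q)² > q.
    multiple : ∃[ n ] 1+q ℚ.≤ fromℕ n ℚ.* h
    multiple = archimedean h 0<h 1+q
    bracket : ∃[ k ] (fromℕ k ℚ.* h) ℚ.* (fromℕ k ℚ.* h) ℚ.≤ q
      × q ℚ.< (fromℕ (suc k) ℚ.* h) ℚ.* (fromℕ (suc k) ℚ.* h)
    bracket = square-bracket h 0≤q (proj₁ multiple) (ℚ.<-≤-trans q<1+q²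
      (square-mono-≤ (ℚ.<⇒≤ 0<1+q) (proj₂ multiple)))
      where
      expand : ∀ q → q ℚ.+ ((1ℚ ℚ.+ q) ℚ.+ q ℚ.* q) ≡ (1ℚ ℚ.+ q) ℚ.* (1ℚ ℚ.+ q)
      expand = solve 1 (λ q → q :+ ((con 1ℚ :+ q) :+ q :* q)
        := (con 1ℚ :+ q) :* (con 1ℚ :+ q)) refl
      q<1+q² : q ℚ.< 1+q ℚ.* 1+q
      q<1+q² = subst (q ℚ.<_) (expand q) (p<p+q q (ℚ.+-mono-<-≤ 0<1+q (square-nonNeg q)))
    k : ℕ
    k = proj₁ bracket
    r : ℚ
    r = fromℕ k ℚ.* h
    0≤r : 0ℚ ℚ.≤ r
    0≤r = *-nonNeg (fromℕ-nonNeg k) (ℚ.<⇒≤ 0<h)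
    r²≤q : r ℚ.* r ℚ.≤ q
    r²≤q = proj₁ (proj₂ bracket)
    q<[r+h]² : q ℚ.< (fromℕ (suc k) ℚ.* h) ℚ.* (fromℕ (suc k) ℚ.* h)
    q<[r+h]² = proj₂ (proj₂ bracket)
    -- From (r - 1)² ≥ 0 and r² ≤ q.
    2r≤1+q : r ℚ.+ r ℚ.≤ 1+q
    2r≤1+q = ℚ.≤-trans (subst (r ℚ.+ r ℚ.≤_) (expand r)
        (p≤p+q (r ℚ.+ r) (square-nonNeg (r ℚ.- 1ℚ))))
      (ℚ.+-monoʳ-≤ 1ℚ r²≤q)
      where
      expand : ∀ r → (r ℚ.+ r) ℚ.+ (r ℚ.- 1ℚ) ℚ.* (r ℚ.- 1ℚ) ≡ 1ℚ ℚ.+ r ℚ.* r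
      expand = solve 1 (λ r → (r :+ r) :+ (r :- con 1ℚ) :* (r :- con 1ℚ)
        := con 1ℚ :+ r :* r) refl
    h+2r≤d : h ℚ.+ (r ℚ.+ r) ℚ.≤ d
    h+2r≤d = ℚ.≤-trans (ℚ.+-mono-≤ h≤1 2r≤1+q) (p≤p+q (1ℚ ℚ.+ 1+q) (ℚ.<⇒≤ 0<ε))
    step : (fromℕ (suc k) ℚ.* h) ℚ.* (fromℕ (suc k) ℚ.* h) ℚ.≤ r ℚ.* r ℚ.+ ε
    step = subst₂ ℚ._≤_ (expand (fromℕ k) h) (cong (r ℚ.* r ℚ.+_) dh≡ε)
      (ℚ.+-monoʳ-≤ (r ℚ.* r)
        (ℚ.*-monoʳ-≤-nonNeg h {{ℚ.nonNegative (ℚ.<⇒≤ 0<h)}} h+2r≤d))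
      where
      expand : ∀ c h →
        (c ℚ.* h) ℚ.* (c ℚ.* h) ℚ.+ (h ℚ.+ (c ℚ.* h ℚ.+ c ℚ.* h)) ℚ.* h
          ≡ ((1ℚ ℚ.+ c) ℚ.* h) ℚ.* ((1ℚ ℚ.+ c) ℚ.* h)
      expand = solve 2 (λ c h →
        (c :* h) :* (c :* h) :+ (h :+ (c :* h :+ c :* h)) :* h
          := ((con 1ℚ :+ c) :* h) :* ((con 1ℚ :+ c) :* h)) refl

∣pq-pr∣<bε : ∀ p q r {b ε} → 0ℚ ℚ.< b → ℚ.∣ p ∣ ℚ.≤ b → ℚ.∣ q ℚ.- r ∣ ℚ.< ε →
  ℚ.∣ p ℚ.* q ℚ.- p ℚ.* r ∣ ℚ.< b ℚ.* ε
∣pq-pr∣<bε p q r {b} {ε} 0<b p≤b q-r<ε = subst (λ s → ℚ.∣ s ∣ ℚ.< b ℚ.* ε) (factor p q r)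
  (subst (ℚ._< b ℚ.* ε) (sym (ℚ.∣p*q∣≡∣p∣*∣q∣ p (q ℚ.- r)))
    (ℚ.≤-<-trans
      (ℚ.*-monoʳ-≤-nonNeg ℚ.∣ q ℚ.- r ∣ {{ℚ.∣-∣-nonNeg (q ℚ.- r)}} p≤b)
      (ℚ.*-monoʳ-<-pos b {{ℚ.positive 0<b}} q-r<ε)))
  where
  open ℚ-Solver
  factor : ∀ p q r → p ℚ.* (q ℚ.- r) ≡ p ℚ.* q ℚ.- p ℚ.* r
  factor = solve 3 (λ p q r → p :* (q :- r) := p :* q :- p :* r) refl

-- The summands 0ℚ come from the terms of 0ℝ in the definition of 0ℝ < x.
q-lower-bound : ∀ p q {b ε ζ} → 0ℚ ℚ.< ε → 0ℚ ℚ.< ζ →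
  0ℚ ℚ.+ ε ℚ.≤ p → ℚ.∣ p ∣ ℚ.≤ b → 0ℚ ℚ.+ b ℚ.* ζ ℚ.≤ p ℚ.* q → 0ℚ ℚ.+ ζ ℚ.≤ q
q-lower-bound p q {b} {ε} {ζ} 0<ε 0<ζ 0+ε≤p ∣p∣≤b 0+bζ≤pq =
  ℚ.≤-trans (ℚ.≤-reflexive (ℚ.+-identityˡ ζ))
    (ℚ.*-cancelˡ-≤-pos p {{ℚ.positive 0<p}} (ℚ.≤-trans
      (ℚ.*-monoʳ-≤-nonNeg ζ {{ℚ.nonNegative (ℚ.<⇒≤ 0<ζ)}} (ℚ.≤-trans (p≤∣p∣ p) ∣p∣≤b))
      (ℚ.≤-trans (ℚ.≤-reflexive (sym (ℚ.+-identityˡ (b ℚ.* ζ)))) 0+bζ≤pq)))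
  where
  0<p : 0ℚ ℚ.< p
  0<p = ℚ.<-≤-trans 0<ε (ℚ.≤-trans (ℚ.≤-reflexive (sym (ℚ.+-identityˡ ε))) 0+ε≤p)

-- The ring of real numbers

private variable
  P Q S : ℕ → Set

always : (∀ n → P n) → Eventually P
always f = 0 , λ n _ → f n

eventually-map : (∀ {n} → P n → Q n) → Eventually P → Eventually Q
eventually-map f (N , p) = N , λ n N≤n → f (p n N≤n)

eventually-zip : (∀ {n} → P n → Q n → S n) → Eventually P → Eventually Q → Eventually S
eventually-zip f (N , p) (M , q) = N ℕ.⊔ M , λ n le →
  f (p n (ℕ.m⊔n≤o⇒m≤o N M le)) (q n (ℕ.m⊔n≤o⇒n≤o N M le))

≈-pointwise : ∀ {x y} → (∀ n → seq x n ≡ seq y n) → x ≈ y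
≈-pointwise {x} {y} eq = mk≈ λ ε 0<ε → always λ n →
  subst (ℚ._< ε) (sym (cong ℚ.∣_∣
    (trans (cong (ℚ._- seq y n) (eq n)) (ℚ.+-inverseʳ (seq y n))))) 0<ε

≈-refl : ∀ {x} → x ≈ x
≈-refl = ≈-pointwise λ _ → refl

≈-sym : ∀ {x y} → x ≈ y → y ≈ x
≈-sym {x} {y} (mk≈ close) = mk≈ λ ε 0<ε →
  eventually-map (λ {n} → subst (ℚ._< ε) (∣p-q∣≡∣q-p∣ (seq x n) (seq y n))) (close ε 0<ε)

∣[p-q]+[r-s]∣<ε : ∀ p q r s {ε} → ℚ.∣ p ℚ.- q ∣ ℚ.< ½ ℚ.* ε → ℚ.∣ r ℚ.- s ∣ ℚ.< ½ ℚ.* ε →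
  ℚ.∣ (p ℚ.- q) ℚ.+ (r ℚ.- s) ∣ ℚ.< ε
∣[p-q]+[r-s]∣<ε p q r s {ε} lt₁ lt₂ =
  ℚ.≤-<-trans (ℚ.∣p+q∣≤∣p∣+∣q∣ (p ℚ.- q) (r ℚ.- s)) (subst (_ ℚ.<_) (½+½ ε) (ℚ.+-mono-< lt₁ lt₂))

≈-trans : ∀ {x y z} → x ≈ y → y ≈ z → x ≈ z
≈-trans {x} {y} {z} (mk≈ xy) (mk≈ yz) = mk≈ λ ε 0<ε → eventually-zip
  (λ {n} lt₁ lt₂ → subst (λ p → ℚ.∣ p ∣ ℚ.< ε) (telescope (seq x n) (seq y n) (seq z n))
    (∣[p-q]+[r-s]∣<ε (seq x n) (seq y n) (seq y n) (seq z n) lt₁ lt₂))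
  (xy (½ ℚ.* ε) (halve 0<ε)) (yz (½ ℚ.* ε) (halve 0<ε))
  where
  open ℚ-Solver
  telescope : ∀ p q r → (p ℚ.- q) ℚ.+ (q ℚ.- r) ≡ p ℚ.- r
  telescope = solve 3 (λ p q r → (p :- q) :+ (q :- r) := p :- r) refl

opaque
  bounded : ∀ x → ∃[ B ] 0ℚ ℚ.< B × Eventually λ n → ℚ.∣ seq x n ∣ ℚ.≤ B
  bounded x with N , close ← cauchy x 1ℚ 1>0 =
    ℚ.∣ seq x N ∣ ℚ.+ 1ℚ , ℚ.+-mono-≤-< (ℚ.0≤∣p∣ (seq x N)) 1>0 , N , λ n N≤n →
      subst (λ p → ℚ.∣ p ∣ ℚ.≤ ℚ.∣ seq x N ∣ ℚ.+ 1ℚ) (regroup (seq x N) (seq x n))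
        (ℚ.≤-trans (ℚ.∣p+q∣≤∣p∣+∣q∣ (seq x N) (seq x n ℚ.- seq x N))
          (ℚ.+-monoʳ-≤ ℚ.∣ seq x N ∣ (ℚ.<⇒≤ (close n N N≤n ℕ.≤-refl))))
    where
    open ℚ-Solver
    regroup : ∀ p q → p ℚ.+ (q ℚ.- p) ≡ q
    regroup = solve 2 (λ p q → p :+ (q :- p) := q) refl

opaque
  unfolding fromℚ _+_ -_ _*_

  +-cong : ∀ {x x′ y y′} → x ≈ x′ → y ≈ y′ → x + y ≈ x′ + y′
  +-cong {x} {x′} {y} {y′} (mk≈ xx′) (mk≈ yy′) = mk≈ λ ε 0<ε → eventually-zip
    (λ {n} lt₁ lt₂ → subst (λ p → ℚ.∣ p ∣ ℚ.< ε)
      (regroup (seq x n) (seq x′ n) (seq y n) (seq y′ n))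
      (∣[p-q]+[r-s]∣<ε (seq x n) (seq x′ n) (seq y n) (seq y′ n) lt₁ lt₂))
    (xx′ (½ ℚ.* ε) (halve 0<ε)) (yy′ (½ ℚ.* ε) (halve 0<ε))
    where
    open ℚ-Solver
    regroup : ∀ p q r s → (p ℚ.- q) ℚ.+ (r ℚ.- s) ≡ (p ℚ.+ r) ℚ.- (q ℚ.+ s)
    regroup = solve 4 (λ p q r s → (p :- q) :+ (r :- s) := (p :+ r) :- (q :+ s)) refl

  -‿cong : ∀ {x y} → x ≈ y → - x ≈ - y
  -‿cong {x} {y} (mk≈ close) = mk≈ λ ε 0<ε → eventually-map
    (λ {n} → subst (ℚ._< ε) (trans (∣p-q∣≡∣q-p∣ (seq x n) (seq y n))
      (cong ℚ.∣_∣ (swap (seq x n) (seq y n)))))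
    (close ε 0<ε)
    where
    open ℚ-Solver
    swap : ∀ p q → q ℚ.- p ≡ (ℚ.- p) ℚ.- (ℚ.- q)
    swap = solve 2 (λ p q → q :- p := (:- p) :- (:- q)) refl

  *-congʳ : ∀ {x y} z → x ≈ y → z * x ≈ z * y
  *-congʳ {x} {y} z (mk≈ close) = mk≈ congruent
    where
    B : ℚ
    B = proj₁ (bounded z)
    0<B : 0ℚ ℚ.< B
    0<B = proj₁ (proj₂ (bounded z))
    congruent : ∀ ε → 0ℚ ℚ.< ε →
      Eventually λ n → ℚ.∣ seq z n ℚ.* seq x n ℚ.- seq z n ℚ.* seq y n ∣ ℚ.< ε
    congruent ε 0<ε = eventually-zip
      (λ {n} z≤B x-y<η → subst (ℚ.∣ seq z n ℚ.* seq x n ℚ.- seq z n ℚ.* seq y n ∣ ℚ.<_)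
        (proj₂ (proj₂ η)) (∣pq-pr∣<bε (seq z n) (seq x n) (seq y n) 0<B z≤B x-y<η))
      (proj₂ (proj₂ (bounded z))) (close (proj₁ η) (proj₁ (proj₂ η)))
      where
      η : ∃[ η ] 0ℚ ℚ.< η × B ℚ.* η ≡ ε
      η = pos-quotient B 0<B ε 0<ε

  +-assoc : ∀ x y z → (x + y) + z ≈ x + (y + z)
  +-assoc x y z = ≈-pointwise λ n → ℚ.+-assoc (seq x n) (seq y n) (seq z n)

  +-comm : ∀ x y → x + y ≈ y + x
  +-comm x y = ≈-pointwise λ n → ℚ.+-comm (seq x n) (seq y n)

  +-identityˡ : ∀ x → 0ℝ + x ≈ x
  +-identityˡ x = ≈-pointwise λ n → ℚ.+-identityˡ (seq x n)

  +-inverseˡ : ∀ x → (- x) + x ≈ 0ℝ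
  +-inverseˡ x = ≈-pointwise λ n → ℚ.+-inverseˡ (seq x n)

  *-assoc : ∀ x y z → (x * y) * z ≈ x * (y * z)
  *-assoc x y z = ≈-pointwise λ n → ℚ.*-assoc (seq x n) (seq y n) (seq z n)

  *-comm : ∀ x y → x * y ≈ y * x
  *-comm x y = ≈-pointwise λ n → ℚ.*-comm (seq x n) (seq y n)

  *-identityˡ : ∀ x → 1ℝ * x ≈ x
  *-identityˡ x = ≈-pointwise λ n → ℚ.*-identityˡ (seq x n)

  *-distribˡ-+ : ∀ x y z → x * (y + z) ≈ x * y + x * z
  *-distribˡ-+ x y z = ≈-pointwise λ n → ℚ.*-distribˡ-+ (seq x n) (seq y n) (seq z n)

  fromℚ-+ : ∀ p q → fromℚ (p ℚ.+ q) ≈ fromℚ p + fromℚ q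
  fromℚ-+ p q = ≈-pointwise λ _ → refl

  fromℚ-* : ∀ p q → fromℚ (p ℚ.* q) ≈ fromℚ p * fromℚ q
  fromℚ-* p q = ≈-pointwise λ _ → refl

  fromℚ-neg : ∀ p → fromℚ (ℚ.- p) ≈ - fromℚ p
  fromℚ-neg p = ≈-pointwise λ _ → refl

*-cong : ∀ {x x′ y y′} → x ≈ x′ → y ≈ y′ → x * y ≈ x′ * y′
*-cong {x} {x′} {y} {y′} xx′ yy′ = ≈-trans (*-congʳ x yy′)
  (≈-trans (*-comm x y′) (≈-trans (*-congʳ y′ xx′) (*-comm y′ x′)))

ℝ-setoid : Setoid 0ℓ 0ℓ
ℝ-setoid = record
  { Carrier = ℝ ; _≈_ = _≈_
  ; isEquivalence = record { refl = ≈-refl ; sym = ≈-sym ; trans = ≈-trans }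
  }

ℝ-commutativeRing : CommutativeRing 0ℓ 0ℓ
ℝ-commutativeRing = record
  { Carrier = ℝ ; _≈_ = _≈_ ; _+_ = _+_ ; _*_ = _*_ ; -_ = -_ ; 0# = 0ℝ ; 1# = 1ℝ
  ; isCommutativeRing = record
    { isRing = record
      { +-isAbelianGroup = record
        { isGroup = record
          { isMonoid = record
            { isSemigroup = record
              { isMagma = record
                { isEquivalence = Setoid.isEquivalence ℝ-setoid
                ; ∙-cong = +-cong
                }
              ; assoc = +-assoc
              }
            ; identity = comm∧idˡ⇒id +-comm +-identityˡ
            }
          ; inverse = comm∧invˡ⇒inv +-comm +-inverseˡ
          ; ⁻¹-cong = -‿cong
          }
        ; comm = +-comm
        }
      ; *-cong = *-cong
      ; *-assoc = *-assoc
      ; *-identity = comm∧idˡ⇒id *-comm *-identityˡ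
      ; distrib = comm∧distrˡ⇒distr +-cong *-comm *-distribˡ-+
      }
    ; *-comm = *-comm
    }
  }
  where open Algebra.Consequences.Setoid ℝ-setoid

-- The order on the real numbers

p+½q+½q : ∀ p q → p ℚ.+ ½ ℚ.* q ℚ.+ ½ ℚ.* q ≡ p ℚ.+ q
p+½q+½q = solve 2 (λ p q → p :+ con ½ :* q :+ con ½ :* q := p :+ q) refl
  where open ℚ-Solver

≤-respʳ-≈ : ∀ {x y z} → y ≈ z → x ≤ y → x ≤ z
≤-respʳ-≈ {x} {y} {z} (mk≈ close) (mk≤ almost) = mk≤ λ ε 0<ε → eventually-zip
  (λ {n} x≤y+ y<z+ → subst (seq x n ℚ.≤_) (p+½q+½q (seq z n) ε)
    (ℚ.≤-trans x≤y+ (ℚ.+-monoˡ-≤ (½ ℚ.* ε) (ℚ.<⇒≤ (∣p-q∣<r⇒p<q+r (seq y n) (seq z n) y<z+)))))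
  (almost (½ ℚ.* ε) (halve 0<ε)) (close (½ ℚ.* ε) (halve 0<ε))

<-respʳ-≈ : ∀ {x y z} → y ≈ z → x < y → x < z
<-respʳ-≈ {x} {y} {z} (mk≈ close) (mk< (ε , 0<ε , gap)) = mk< (½ ℚ.* ε , halve 0<ε , eventually-zip
  (λ {n} x+≤y y<z+ → cancel (seq x n) (seq z n)
    (ℚ.≤-trans x+≤y (ℚ.<⇒≤ (∣p-q∣<r⇒p<q+r (seq y n) (seq z n) y<z+))))
  gap (close (½ ℚ.* ε) (halve 0<ε)))
  where
  open ℚ-Solver
  cancelˡ : ∀ p ε → p ℚ.+ ε ℚ.- ½ ℚ.* ε ≡ p ℚ.+ ½ ℚ.* ε
  cancelˡ = solve 2 (λ p e → p :+ e :- con ½ :* e := p :+ con ½ :* e) refl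
  cancelʳ : ∀ p ε → p ℚ.+ ½ ℚ.* ε ℚ.- ½ ℚ.* ε ≡ p
  cancelʳ = solve 2 (λ p e → p :+ con ½ :* e :- con ½ :* e := p) refl
  cancel : ∀ p q → p ℚ.+ ε ℚ.≤ q ℚ.+ ½ ℚ.* ε → p ℚ.+ ½ ℚ.* ε ℚ.≤ q
  cancel p q le = subst₂ ℚ._≤_ (cancelˡ p ε) (cancelʳ q ε) (ℚ.+-monoˡ-≤ (ℚ.- (½ ℚ.* ε)) le)

≤-respˡ-≈ : ∀ {x y z} → x ≈ z → x ≤ y → z ≤ y
≤-respˡ-≈ {x} {y} {z} (mk≈ close) (mk≤ almost) = mk≤ λ ε 0<ε → eventually-zip
  (λ {n} x-z<ε x≤y+ → ℚ.≤-trans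
    (ℚ.<⇒≤ (∣p-q∣<r⇒p<q+r (seq z n) (seq x n)
      (subst (ℚ._< ½ ℚ.* ε) (∣p-q∣≡∣q-p∣ (seq x n) (seq z n)) x-z<ε)))
    (subst (seq x n ℚ.+ ½ ℚ.* ε ℚ.≤_) (p+½q+½q (seq y n) ε) (ℚ.+-monoˡ-≤ (½ ℚ.* ε) x≤y+)))
  (close (½ ℚ.* ε) (halve 0<ε)) (almost (½ ℚ.* ε) (halve 0<ε))

<-respˡ-≈ : ∀ {x y z} → x ≈ z → x < y → z < y
<-respˡ-≈ {x} {y} {z} (mk≈ close) (mk< (ε , 0<ε , gap)) = mk< (½ ℚ.* ε , halve 0<ε , eventually-zip
  (λ {n} x-z<ε x+ε≤y → ℚ.≤-trans
    (subst (seq z n ℚ.+ ½ ℚ.* ε ℚ.≤_) (p+½q+½q (seq x n) ε)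
      (ℚ.+-monoˡ-≤ (½ ℚ.* ε) (ℚ.<⇒≤ (∣p-q∣<r⇒p<q+r (seq z n) (seq x n)
        (subst (ℚ._< ½ ℚ.* ε) (∣p-q∣≡∣q-p∣ (seq x n) (seq z n)) x-z<ε)))))
    x+ε≤y)
  (close (½ ℚ.* ε) (halve 0<ε)) gap)

opaque
  unfolding fromℚ _+_ -_ _*_

  ≤-+-monoˡ : ∀ {x y} z → x ≤ y → x + z ≤ y + z
  ≤-+-monoˡ {x} {y} z (mk≤ almost) = mk≤ λ ε 0<ε → eventually-map
    (λ {n} le → subst (seq x n ℚ.+ seq z n ℚ.≤_) (swap (seq y n) ε (seq z n))
      (ℚ.+-monoˡ-≤ (seq z n) le))
    (almost ε 0<ε)
    where
    open ℚ-Solver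
    swap : ∀ p q r → p ℚ.+ q ℚ.+ r ≡ p ℚ.+ r ℚ.+ q
    swap = solve 3 (λ p q r → p :+ q :+ r := p :+ r :+ q) refl

  <-+-monoˡ : ∀ {x y} z → x < y → x + z < y + z
  <-+-monoˡ {x} {y} z (mk< (ε , 0<ε , gap)) = mk< (ε , 0<ε , eventually-map
    (λ {n} le → subst (ℚ._≤ seq y n ℚ.+ seq z n) (swap (seq x n) ε (seq z n))
      (ℚ.+-monoˡ-≤ (seq z n) le))
    gap)
    where
    open ℚ-Solver
    swap : ∀ p q r → p ℚ.+ q ℚ.+ r ≡ p ℚ.+ r ℚ.+ q
    swap = solve 3 (λ p q r → p :+ q :+ r := p :+ r :+ q) refl

  fromℚ-pos : ∀ {q} → 0ℚ ℚ.< q → 0ℝ < fromℚ q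
  fromℚ-pos {q} 0<q = mk< (q , 0<q , always λ _ → ℚ.≤-reflexive (ℚ.+-identityˡ q))

  <⇒≤ : ∀ {x y} → x < y → x ≤ y
  <⇒≤ {x} {y} (mk< (ε , 0<ε , gap)) = mk≤ λ η 0<η → eventually-map
    (λ {n} le → ℚ.≤-trans (p≤p+q (seq x n) (ℚ.<⇒≤ 0<ε))
      (ℚ.≤-trans le (p≤p+q (seq y n) (ℚ.<⇒≤ 0<η))))
    gap

  -- Half of the gap of `x` absorbs the amount by which terms of `y` may fall below 0; the other
  -- half remains as the gap of the sum.
  0<x+y : ∀ {x y} → 0ℝ < x → 0ℝ ≤ y → 0ℝ < x + y
  0<x+y {x} {y} (mk< (ε , 0<ε , gap)) (mk≤ almost) = mk< (½ ℚ.* ε , halve 0<ε , eventually-zip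
    (λ {n} ε≤x 0≤y+ → ℚ.≤-trans (ℚ.+-monoʳ-≤ 0ℚ
        (subst₂ ℚ._≤_ (cancelˡ ε) (cancelʳ (seq x n) (seq y n) ε)
          (ℚ.+-monoˡ-≤ (ℚ.- (½ ℚ.* ε)) (ℚ.+-mono-≤ ε≤x 0≤y+))))
      (ℚ.≤-reflexive (ℚ.+-identityˡ _)))
    gap (almost (½ ℚ.* ε) (halve 0<ε)))
    where
    open ℚ-Solver
    cancelˡ : ∀ ε → 0ℚ ℚ.+ ε ℚ.+ 0ℚ ℚ.- ½ ℚ.* ε ≡ ½ ℚ.* ε
    cancelˡ = solve 1 (λ e → con 0ℚ :+ e :+ con 0ℚ :- con ½ :* e := con ½ :* e) refl
    cancelʳ : ∀ p q ε → p ℚ.+ (q ℚ.+ ½ ℚ.* ε) ℚ.- ½ ℚ.* ε ≡ p ℚ.+ q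
    cancelʳ = solve 3 (λ p q e → p :+ (q :+ con ½ :* e) :- con ½ :* e := p :+ q) refl

  0<x*y : ∀ {x y} → 0ℝ < x → 0ℝ < y → 0ℝ < x * y
  0<x*y {x} {y} (mk< (ε , 0<ε , gapˣ)) (mk< (η , 0<η , gapʸ)) =
    mk< (ε ℚ.* η , *-pos 0<ε 0<η , eventually-zip
      (λ {n} ε≤x η≤y → bound (seq x n) (seq y n)
        (ℚ.≤-trans (ℚ.≤-reflexive (sym (ℚ.+-identityˡ ε))) ε≤x)
        (ℚ.≤-trans (ℚ.≤-reflexive (sym (ℚ.+-identityˡ η))) η≤y))
      gapˣ gapʸ)
    where
    bound : ∀ p q → ε ℚ.≤ p → η ℚ.≤ q → 0ℚ ℚ.+ ε ℚ.* η ℚ.≤ p ℚ.* q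
    bound p q ε≤p η≤q = ℚ.≤-trans (ℚ.≤-reflexive (ℚ.+-identityˡ (ε ℚ.* η)))
      (ℚ.≤-trans (ℚ.*-monoˡ-≤-nonNeg ε {{ℚ.nonNegative (ℚ.<⇒≤ 0<ε)}} η≤q)
        (ℚ.*-monoʳ-≤-nonNeg q {{ℚ.nonNegative (ℚ.≤-trans (ℚ.<⇒≤ 0<η) η≤q)}} ε≤p))

  0≤x*x : ∀ x → 0ℝ ≤ x * x
  0≤x*x x = mk≤ λ ε 0<ε → always λ n →
    ℚ.≤-trans (square-nonNeg (seq x n)) (p≤p+q _ (ℚ.<⇒≤ 0<ε))

  -- With η a lower bound for the terms q of `y`, the slack εη in the product gives 0 ≤ pq + εη ≤ (p
  -- + ε)q, and the positive q cancels whatever the sign of p.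
  0≤x*y⇒0≤x : ∀ {x y} → 0ℝ < y → 0ℝ ≤ x * y → 0ℝ ≤ x
  0≤x*y⇒0≤x {x} {y} (mk< (η , 0<η , gap)) (mk≤ almost) = mk≤ λ ε 0<ε → eventually-zip
    (λ {n} → bound ε 0<ε (seq x n) (seq y n)) gap (almost (ε ℚ.* η) (*-pos 0<ε 0<η))
    where
    bound : ∀ ε → 0ℚ ℚ.< ε → ∀ p q →
      0ℚ ℚ.+ η ℚ.≤ q → 0ℚ ℚ.≤ p ℚ.* q ℚ.+ ε ℚ.* η → 0ℚ ℚ.≤ p ℚ.+ ε
    bound ε 0<ε p q 0+η≤q 0≤pq+εη = ℚ.*-cancelʳ-≤-pos q {{ℚ.positive (ℚ.<-≤-trans 0<η η≤q)}}
      (subst₂ ℚ._≤_ (sym (ℚ.*-zeroˡ q)) (sym (ℚ.*-distribʳ-+ q p ε))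
        (ℚ.≤-trans 0≤pq+εη
          (ℚ.+-monoʳ-≤ (p ℚ.* q) (ℚ.*-monoˡ-≤-nonNeg ε {{ℚ.nonNegative (ℚ.<⇒≤ 0<ε)}} η≤q))))
      where
      η≤q : η ℚ.≤ q
      η≤q = ℚ.≤-trans (ℚ.≤-reflexive (sym (ℚ.+-identityˡ η))) 0+η≤q

  -- If the terms of `x` are positive and at most B, a gap η of the product leaves the gap η/B for
  -- `y`.
  0<x*y⇒0<y : ∀ {x y} → 0ℝ < x → 0ℝ < x * y → 0ℝ < y
  0<x*y⇒0<y {x} {y} (mk< (ε , 0<ε , gapˣ)) (mk< (η , 0<η , gap)) =
    mk< (proj₁ ζ , proj₁ (proj₂ ζ) , eventually-zip
      (λ {n} (ε≤x , x≤B) η≤xy → q-lower-bound (seq x n) (seq y n) 0<ε (proj₁ (proj₂ ζ))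
        ε≤x x≤B (subst (λ t → 0ℚ ℚ.+ t ℚ.≤ seq x n ℚ.* seq y n) (sym (proj₂ (proj₂ ζ))) η≤xy))
      (eventually-zip _,_ gapˣ (proj₂ (proj₂ (bounded x)))) gap)
    where
    B : ℚ
    B = proj₁ (bounded x)
    ζ : ∃[ ζ ] 0ℚ ℚ.< ζ × B ℚ.* ζ ≡ η
    ζ = pos-quotient B (proj₁ (proj₂ (bounded x))) η 0<η

-- Square roots

module Sqrt (x : ℝ) where

  -- Terms of a nonnegative real may still be negative by a vanishing amount. After truncation every
  -- term has an approximate root, so `√` is a total operation.
  q⁺ : ℕ → ℚ
  q⁺ n = seq x n ℚ.⊔ 0ℚ

  approximation : ∀ n → ∃[ r ] 0ℚ ℚ.≤ r × r ℚ.* r ℚ.≤ q⁺ n × q⁺ n ℚ.< r ℚ.* r ℚ.+ δ n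
  approximation n = approx-sqrt (δ n) (ℚ.p≤q⊔p (seq x n) 0ℚ) (δ-pos n)

  root : ℕ → ℚ
  root n = proj₁ (approximation n)

  root-nonNeg : ∀ n → 0ℚ ℚ.≤ root n
  root-nonNeg n = proj₁ (proj₂ (approximation n))

  root²≤ : ∀ n → root n ℚ.* root n ℚ.≤ q⁺ n
  root²≤ n = proj₁ (proj₂ (proj₂ (approximation n)))

  root²> : ∀ n → q⁺ n ℚ.< root n ℚ.* root n ℚ.+ δ n
  root²> n = proj₂ (proj₂ (proj₂ (approximation n)))

  -- If root m were at least root n + ε, the squares would differ by ε².
  root-close : ∀ ε → 0ℚ ℚ.< ε → ∀ m n →
    ℚ.∣ seq x m ℚ.- seq x n ∣ ℚ.< ½ ℚ.* (ε ℚ.* ε) → δ n ℚ.≤ ½ ℚ.* (ε ℚ.* ε) →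
    root m ℚ.< root n ℚ.+ ε
  root-close ε 0<ε m n close δ≤ = ℚ.≰⇒> λ rn+ε≤rm → ℚ.<-irrefl refl
    (ℚ.<-≤-trans q⁺m< (ℚ.≤-trans rn²+ε²≤[rn+ε]² (ℚ.≤-trans
      (square-mono-≤ 0≤rn+ε rn+ε≤rm) (root²≤ m))))
    where
    open ℚ-Solver
    -- One half of ε² pays for the distance of the two terms, which truncation does not increase,
    -- the other half for the tolerance `δ n`.
    η = ½ ℚ.* (ε ℚ.* ε)
    0<η : 0ℚ ℚ.< η
    0<η = halve (*-pos 0<ε 0<ε)
    0≤rn+ε : 0ℚ ℚ.≤ root n ℚ.+ ε
    0≤rn+ε = ℚ.≤-trans (root-nonNeg n) (p≤p+q (root n) (ℚ.<⇒≤ 0<ε))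
    q⁺m≤q⁺n+η : q⁺ m ℚ.≤ q⁺ n ℚ.+ η
    q⁺m≤q⁺n+η = ℚ.⊔-lub
      (ℚ.≤-trans (ℚ.<⇒≤ (∣p-q∣<r⇒p<q+r (seq x m) (seq x n) close))
        (ℚ.+-monoˡ-≤ η (ℚ.p≤p⊔q (seq x n) 0ℚ)))
      (ℚ.≤-trans (ℚ.p≤q⊔p (seq x n) 0ℚ) (p≤p+q (q⁺ n) (ℚ.<⇒≤ 0<η)))
    collect : ∀ r ε → r ℚ.* r ℚ.+ ½ ℚ.* (ε ℚ.* ε) ℚ.+ ½ ℚ.* (ε ℚ.* ε) ≡ r ℚ.* r ℚ.+ ε ℚ.* ε
    collect = solve 2 (λ r e → r :* r :+ con ½ :* (e :* e) :+ con ½ :* (e :* e)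
      := r :* r :+ e :* e) refl
    q⁺m< : q⁺ m ℚ.< root n ℚ.* root n ℚ.+ ε ℚ.* ε
    q⁺m< = ℚ.≤-<-trans q⁺m≤q⁺n+η (subst (q⁺ n ℚ.+ η ℚ.<_) (collect (root n) ε)
      (ℚ.+-monoˡ-< η (ℚ.<-≤-trans (root²> n) (ℚ.+-monoʳ-≤ (root n ℚ.* root n) δ≤))))
    expand : ∀ r ε → r ℚ.* r ℚ.+ ε ℚ.* ε ℚ.+ (r ℚ.* ε ℚ.+ r ℚ.* ε) ≡ (r ℚ.+ ε) ℚ.* (r ℚ.+ ε)
    expand = solve 2 (λ r e → r :* r :+ e :* e :+ (r :* e :+ r :* e) := (r :+ e) :* (r :+ e)) refl
    rε≥0 : 0ℚ ℚ.≤ root n ℚ.* ε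
    rε≥0 = *-nonNeg (root-nonNeg n) (ℚ.<⇒≤ 0<ε)
    rn²+ε²≤[rn+ε]² : root n ℚ.* root n ℚ.+ ε ℚ.* ε ℚ.≤ (root n ℚ.+ ε) ℚ.* (root n ℚ.+ ε)
    rn²+ε²≤[rn+ε]² = subst (root n ℚ.* root n ℚ.+ ε ℚ.* ε ℚ.≤_) (expand (root n) ε)
      (p≤p+q _ (ℚ.+-mono-≤ rε≥0 rε≥0))

  root-cauchy : Cauchy root
  root-cauchy ε 0<ε =
    N ℕ.⊔ M , λ m n le₁ le₂ →
      let N≤m = ℕ.m⊔n≤o⇒m≤o N M le₁
          N≤n = ℕ.m⊔n≤o⇒m≤o N M le₂
          M≤m = ℕ.m⊔n≤o⇒n≤o N M le₁
          M≤n = ℕ.m⊔n≤o⇒n≤o N M le₂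
      in ∣p-q∣<r (root m) (root n)
        (root-close ε 0<ε m n (close m n N≤m N≤n) (δ≤ n M≤n))
        (root-close ε 0<ε n m (close n m N≤n N≤m) (δ≤ m M≤m))
    where
    0<η = halve (*-pos 0<ε 0<ε)
    N = proj₁ (cauchy x _ 0<η)
    close = proj₂ (cauchy x _ 0<η)
    M = proj₁ (δ-vanishing _ 0<η)
    δ≤ = proj₂ (δ-vanishing _ 0<η)

  √ : ℝ
  √ = mkℝ root root-cauchy

  opaque
    unfolding fromℚ _*_

    √-nonNeg : 0ℝ ≤ √
    √-nonNeg = mk≤ λ ε 0<ε → always λ n →
      ℚ.≤-trans (root-nonNeg n) (p≤p+q (root n) (ℚ.<⇒≤ 0<ε))

    -- Nonnegativity makes the terms of `x` eventually at least -ε/2, so truncation raises them by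
    -- at most ε/2; the error of the approximate roots is bounded by `δ n`.
    √*√ : 0ℝ ≤ x → √ * √ ≈ x
    √*√ (mk≤ almost) = mk≈ λ ε 0<ε → eventually-zip
      (λ {n} 0≤x+½ε δ≤½ε → ∣p-q∣<r (root n ℚ.* root n) (seq x n)
        (ℚ.≤-<-trans (root²≤ n) (ℚ.≤-<-trans
          (ℚ.⊔-lub (p≤p+q (seq x n) (ℚ.<⇒≤ (halve 0<ε))) 0≤x+½ε)
          (ℚ.+-monoʳ-< (seq x n) (½ε<ε 0<ε))))
        (ℚ.≤-<-trans (ℚ.p≤p⊔q (seq x n) 0ℚ) (ℚ.<-trans (root²> n)
          (ℚ.+-monoʳ-< (root n ℚ.* root n) (ℚ.≤-<-trans δ≤½ε (½ε<ε 0<ε))))))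
      (almost _ (halve 0<ε)) (δ-vanishing _ (halve 0<ε))
      where
      ½ε<ε : ∀ {ε} → 0ℚ ℚ.< ε → ½ ℚ.* ε ℚ.< ε
      ½ε<ε {ε} 0<ε = subst (½ ℚ.* ε ℚ.<_) (½+½ ε) (p<p+q (½ ℚ.* ε) (halve 0<ε))

-- Polynomial identities over the real numbers

ℝ-ACR : ACR.AlmostCommutativeRing 0ℓ 0ℓ
ℝ-ACR = ACR.fromCommutativeRing ℝ-commutativeRing

-- The solver has to compare coefficients, and equality is decidable on ℚ but not on ℝ. Rational
-- coefficients also let it compute with constants such as 1/48.
fromℚ-morphism : ℚ.+-*-rawRing ACR.-Raw-AlmostCommutative⟶ ℝ-ACR
fromℚ-morphism = record
  { ⟦_⟧    = fromℚ
  ; +-homo = fromℚ-+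
  ; *-homo = fromℚ-*
  ; -‿homo = fromℚ-neg
  ; 0-homo = ≈-refl
  ; 1-homo = ≈-refl
  }

fromℚ-≟ : WeaklyDecidable (ACR.Induced-equivalence fromℚ-morphism)
fromℚ-≟ p q = Maybe.map (λ { refl → ≈-refl }) (dec⇒maybe (p ℚ.≟ q))

module ℝ-Solver = Algebra.Solver.Ring ℚ.+-*-rawRing ℝ-ACR fromℚ-morphism fromℚ-≟

open ℝ-Solver using (con; var; _:+_; _:*_; :-_; prove; solve; _:=_) renaming (Polynomial to Expr)

-- Characteristic polynomials over this ring are, by evaluation, the solver's
-- syntax for characteristic polynomials over ℝ.
exprRing : ℕ → RawRing 0ℓ 0ℓ
exprRing m = record
  { Carrier = Expr m ; _≈_ = _≡_ ; _+_ = _:+_ ; _*_ = _:*_ ; -_ = :-_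
  ; 0# = con 0ℚ ; 1# = con 1ℚ }

-- Characteristic polynomials of 3 × 3 matrices

module Cubic {c ℓ} (R : RawRing c ℓ) where
  open RawRing R using (Carrier; 1#)
    renaming (_+_ to _⊕_; _*_ to _⊗_; -_ to ⊖_)

  -- X³ - e₁X² + e₂X - e₃, with the elementary symmetric functions of the roots as parameters.
  cubic : (e₁ e₂ e₃ : Carrier) → List Carrier
  cubic e₁ e₂ e₃ = ⊖ e₃ List.∷ e₂ List.∷ ⊖ e₁ List.∷ 1# List.∷ List.[]

  module _ (A : Matrix Carrier 3) where

    trace : Carrier
    trace = A 0F 0F ⊕ A 1F 1F ⊕ A 2F 2F

    minor : (i j k l : Fin 3) → Carrier
    minor i j k l = A i k ⊗ A j l ⊕ (⊖ (A i l ⊗ A j k))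

    principalMinors : Carrier
    principalMinors = minor 0F 1F 0F 1F ⊕ minor 0F 2F 0F 2F ⊕ minor 1F 2F 1F 2F

    determinant : Carrier
    determinant = A 0F 0F ⊗ minor 1F 2F 1F 2F
      ⊕ (⊖ (A 0F 1F ⊗ minor 1F 2F 0F 2F)) ⊕ A 0F 2F ⊗ minor 1F 2F 0F 1F

open Cubic ℝ-rawRing

charPoly₃ : ∀ A → charPoly A ≈ₚ cubic (trace A) (principalMinors A) (determinant A)
charPoly₃ A = coefficients
  where
  R = exprRing 9
  module C = Cubic R
  ρ = A 0F 0F Vec.∷ A 0F 1F Vec.∷ A 0F 2F Vec.∷
      A 1F 0F Vec.∷ A 1F 1F Vec.∷ A 1F 2F Vec.∷
      A 2F 0F Vec.∷ A 2F 1F Vec.∷ A 2F 2F Vec.∷ Vec.[]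
  M : Matrix (Expr 9) 3
  -- `combine` numbers the entries row by row, which is the order of the environment `ρ`.
  M i j = var (combine i j)
  lhs rhs : ℕ → Expr 9
  lhs = Polynomial.coeff R (CharacteristicPolynomial.charPoly R M)
  rhs = Polynomial.coeff R (C.cubic (C.trace M) (C.principalMinors M) (C.determinant M))
  coefficients : charPoly A ≈ₚ cubic (trace A) (principalMinors A) (determinant A)
  coefficients 0 = prove ρ (lhs 0) (rhs 0) ≈-refl
  coefficients 1 = prove ρ (lhs 1) (rhs 1) ≈-refl
  coefficients 2 = prove ρ (lhs 2) (rhs 2) ≈-refl
  coefficients 3 = prove ρ (lhs 3) (rhs 3) ≈-refl
  coefficients (suc (suc (suc (suc _)))) = ≈-refl

rootProduct₃ : ∀ y z → rootProduct (0ℝ ∷ y ∷ z ∷ []) ≈ₚ cubic (y + z) (y * z) 0ℝ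
rootProduct₃ y z = coefficients
  where
  R = exprRing 2
  module C = Cubic R
  ρ = y Vec.∷ z Vec.∷ Vec.[]
  v w : Expr 2
  v = var 0F
  w = var 1F
  lhs rhs : ℕ → Expr 2
  lhs = Polynomial.coeff R (CharacteristicPolynomial.rootProduct R (con 0ℚ ∷ v ∷ w ∷ []))
  rhs = Polynomial.coeff R (C.cubic (v :+ w) (v :* w) (con 0ℚ))
  coefficients : rootProduct (0ℝ ∷ y ∷ z ∷ []) ≈ₚ cubic (y + z) (y * z) 0ℝ
  coefficients 0 = prove ρ (lhs 0) (rhs 0) ≈-refl
  coefficients 1 = prove ρ (lhs 1) (rhs 1) ≈-refl
  coefficients 2 = prove ρ (lhs 2) (rhs 2) ≈-refl
  coefficients 3 = prove ρ (lhs 3) (rhs 3) ≈-refl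
  coefficients (suc (suc (suc (suc _)))) = ≈-refl

open SetoidReasoning ℝ-setoid

-‿cancel : ∀ {x y} → - x ≈ - y → x ≈ y
-‿cancel {x} {y} -x≈-y = begin
  x     ≈⟨ involutive x ⟨
  - - x ≈⟨ -‿cong -x≈-y ⟩
  - - y ≈⟨ involutive y ⟩
  y     ∎
  where
  involutive : ∀ x → - - x ≈ x
  involutive = solve 1 (λ x → :- (:- x) := x) ≈-refl

hasSpectrum⇒ : ∀ A {y z} → HasSpectrum A (0ℝ ∷ y ∷ z ∷ []) →
  trace A ≈ y + z × principalMinors A ≈ y * z
hasSpectrum⇒ A {y} {z} spec = -‿cancel (coefficient 2) , coefficient 1
  where
  coefficient : cubic (trace A) (principalMinors A) (determinant A) ≈ₚ cubic (y + z) (y * z) 0ℝ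
  coefficient k = ≈-trans (≈-sym (charPoly₃ A k)) (≈-trans (spec k) (rootProduct₃ y z k))

hasSpectrum⇐ : ∀ A {y z} → trace A ≈ y + z → principalMinors A ≈ y * z → determinant A ≈ 0ℝ →
  HasSpectrum A (0ℝ ∷ y ∷ z ∷ [])
hasSpectrum⇐ A {y} {z} e₁ e₂ e₃ k =
  ≈-trans (charPoly₃ A k) (≈-trans (cubic-cong k) (≈-sym (rootProduct₃ y z k)))
  where
  cubic-cong : cubic (trace A) (principalMinors A) (determinant A) ≈ₚ cubic (y + z) (y * z) 0ℝ
  cubic-cong 0 = -‿cong e₃
  cubic-cong 1 = e₂
  cubic-cong 2 = -‿cong e₁
  cubic-cong (suc (suc (suc _))) = ≈-refl

trace-cong : ∀ {A B} → (∀ i j → A i j ≈ B i j) → trace A ≈ trace B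
trace-cong A≈B = +-cong (+-cong (A≈B 0F 0F) (A≈B 1F 1F)) (A≈B 2F 2F)

principalMinors-cong : ∀ {A B} → (∀ i j → A i j ≈ B i j) → principalMinors A ≈ principalMinors B
principalMinors-cong {A} {B} A≈B =
  +-cong (+-cong (minor-cong 0F 1F 0F 1F) (minor-cong 0F 2F 0F 2F)) (minor-cong 1F 2F 1F 2F)
  where
  minor-cong : ∀ i j k l → minor A i j k l ≈ minor B i j k l
  minor-cong i j k l = +-cong (*-cong (A≈B i k) (A≈B j l)) (-‿cong (*-cong (A≈B i l) (A≈B j k)))

-- Weighted Laplacians of P₃

laplacian : ℝ → ℝ → Matrix ℝ 3
laplacian a b 0F 0F = a
laplacian a b 0F 1F = - a
laplacian a b 0F 2F = 0ℝ
laplacian a b 1F 0F = - a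
laplacian a b 1F 1F = a + b
laplacian a b 1F 2F = - b
laplacian a b 2F 0F = 0ℝ
laplacian a b 2F 1F = - b
laplacian a b 2F 2F = b

trace-laplacian : ∀ a b → trace (laplacian a b) ≈ fromℚ (+ 2 / 1) * (a + b)
trace-laplacian = solve 2 (λ a b → a :+ (a :+ b) :+ b := con (+ 2 / 1) :* (a :+ b)) ≈-refl

principalMinors-laplacian : ∀ a b → principalMinors (laplacian a b) ≈ fromℚ (+ 3 / 1) * (a * b)
principalMinors-laplacian = solve 2 (λ a b →
  (a :* (a :+ b) :+ :- ((:- a) :* (:- a))) :+ (a :* b :+ :- (con 0ℚ :* con 0ℚ))
    :+ ((a :+ b) :* b :+ :- ((:- b) :* (:- b)))
  := con (+ 3 / 1) :* (a :* b)) ≈-refl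

determinant-laplacian : ∀ a b → determinant (laplacian a b) ≈ 0ℝ
determinant-laplacian = solve 2 (λ a b →
  a :* ((a :+ b) :* b :+ :- ((:- b) :* (:- b)))
    :+ :- ((:- a) :* ((:- a) :* b :+ :- ((:- b) :* con 0ℚ)))
    :+ con 0ℚ :* ((:- a) :* (:- b) :+ :- ((a :+ b) :* con 0ℚ))
  := con 0ℚ) ≈-refl

laplacian-∈𝒮ᴸ : ∀ {a b} → 0ℝ < a → 0ℝ < b → 𝒮ᴸ (path 3) (laplacian a b)
laplacian-∈𝒮ᴸ {a} {b} 0<a 0<b = record
  { symmetric = λ
    { 0F 0F → ≈-refl ; 0F 1F → ≈-refl ; 0F 2F → ≈-refl
    ; 1F 0F → ≈-refl ; 1F 1F → ≈-refl ; 1F 2F → ≈-refl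
    ; 2F 0F → ≈-refl ; 2F 1F → ≈-refl ; 2F 2F → ≈-refl
    }
  ; adjacent = λ
    { 0F 1F _ → 0<x⇒-x<0 0<a ; 1F 0F _ → 0<x⇒-x<0 0<a
    ; 1F 2F _ → 0<x⇒-x<0 0<b ; 2F 1F _ → 0<x⇒-x<0 0<b
    ; 0F 0F () ; 0F 2F () ; 1F 1F () ; 2F 0F () ; 2F 2F ()
    }
  ; nonadjacent = λ
    { 0F 2F _ _ → ≈-refl ; 2F 0F _ _ → ≈-refl
    ; 0F 0F i≢j _ → contradiction refl i≢j
    ; 1F 1F i≢j _ → contradiction refl i≢j
    ; 2F 2F i≢j _ → contradiction refl i≢j
    ; 0F 1F _ ¬adj → contradiction refl ¬adj
    ; 1F 0F _ ¬adj → contradiction refl ¬adj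
    ; 1F 2F _ ¬adj → contradiction refl ¬adj
    ; 2F 1F _ ¬adj → contradiction refl ¬adj
    }
  ; diagonal = λ
    { 0F → solve 1 (λ a → a := :- (con 0ℚ :+ (:- a :+ (con 0ℚ :+ con 0ℚ)))) ≈-refl a
    ; 1F → solve 2 (λ a b → a :+ b := :- (:- a :+ (con 0ℚ :+ (:- b :+ con 0ℚ)))) ≈-refl a b
    ; 2F → solve 1 (λ b → b := :- (con 0ℚ :+ (:- b :+ (con 0ℚ :+ con 0ℚ)))) ≈-refl b
    }
  }
  where
  0<x⇒-x<0 : ∀ {x} → 0ℝ < x → - x < 0ℝ
  0<x⇒-x<0 {x} 0<x = <-respˡ-≈ (+-identityˡ (- x))
    (<-respʳ-≈ (solve 1 (λ x → x :+ :- x := con 0ℚ) ≈-refl x) (<-+-monoˡ (- x) 0<x))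

-- Symmetry and the vanishing row sums leave one parameter per edge, so the trace and minors of any
-- realizing matrix can be computed in the two weights.
𝒮ᴸ-path₃ : ∀ {A} → 𝒮ᴸ (path 3) A → ∀ i j → A i j ≈ laplacian (- A 0F 1F) (- A 1F 2F) i j
𝒮ᴸ-path₃ {A} L = entry
  where
  open 𝒮ᴸ L
  x = A 0F 1F
  y = A 1F 2F
  A₀₂≈0 : A 0F 2F ≈ 0ℝ
  A₀₂≈0 = nonadjacent 0F 2F (λ ()) (λ ())
  A₂₀≈0 : A 2F 0F ≈ 0ℝ
  A₂₀≈0 = nonadjacent 2F 0F (λ ()) (λ ())
  A₁₀≈x : A 1F 0F ≈ x
  A₁₀≈x = symmetric 1F 0F
  A₂₁≈y : A 2F 1F ≈ y
  A₂₁≈y = symmetric 2F 1F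
  x≈--x : ∀ x → x ≈ - - x
  x≈--x = solve 1 (λ x → x := :- (:- x)) ≈-refl
  entry : ∀ i j → A i j ≈ laplacian (- x) (- y) i j
  entry 0F 0F = begin
    A 0F 0F                          ≈⟨ diagonal 0F ⟩
    -- The unfolded row sum: the leading `0ℝ` replaces the diagonal entry, the last one ends the
    -- sum.
    - (0ℝ + (x + (A 0F 2F + 0ℝ)))
      ≈⟨ -‿cong (+-cong ≈-refl (+-cong ≈-refl (+-cong A₀₂≈0 ≈-refl))) ⟩
    - (0ℝ + (x + (0ℝ + 0ℝ)))
      ≈⟨ solve 1 (λ x → :- (con 0ℚ :+ (x :+ (con 0ℚ :+ con 0ℚ))) := :- x) ≈-refl x ⟩
    - x                              ∎
  entry 0F 1F = x≈--x x
  entry 0F 2F = A₀₂≈0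
  entry 1F 0F = ≈-trans A₁₀≈x (x≈--x x)
  entry 1F 1F = begin
    A 1F 1F                          ≈⟨ diagonal 1F ⟩
    - (A 1F 0F + (0ℝ + (y + 0ℝ)))    ≈⟨ -‿cong (+-cong A₁₀≈x ≈-refl) ⟩
    - (x + (0ℝ + (y + 0ℝ)))
      ≈⟨ solve 2 (λ x y → :- (x :+ (con 0ℚ :+ (y :+ con 0ℚ))) := (:- x) :+ (:- y)) ≈-refl x y ⟩
    - x + - y                        ∎
  entry 1F 2F = x≈--x y
  entry 2F 0F = A₂₀≈0
  entry 2F 1F = ≈-trans A₂₁≈y (x≈--x y)
  entry 2F 2F = begin
    A 2F 2F                              ≈⟨ diagonal 2F ⟩
    - (A 2F 0F + (A 2F 1F + (0ℝ + 0ℝ)))  ≈⟨ -‿cong (+-cong A₂₀≈0 (+-cong A₂₁≈y ≈-refl)) ⟩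
    - (0ℝ + (y + (0ℝ + 0ℝ)))
      ≈⟨ solve 1 (λ y → :- (con 0ℚ :+ (y :+ (con 0ℚ :+ con 0ℚ))) := :- y) ≈-refl y ⟩
    - y                                  ∎

-- The realizability criterion

x≤y⇒0≤y-x : ∀ {x y} → x ≤ y → 0ℝ ≤ y + - x
x≤y⇒0≤y-x {x} x≤y = ≤-respˡ-≈ (solve 1 (λ x → x :+ :- x := con 0ℚ) ≈-refl x) (≤-+-monoˡ (- x) x≤y)

0≤y-x⇒x≤y : ∀ {x y} → 0ℝ ≤ y + - x → x ≤ y
0≤y-x⇒x≤y {x} {y} 0≤y-x = ≤-respˡ-≈ (+-identityˡ x)
  (≤-respʳ-≈ (solve 2 (λ x y → y :+ :- x :+ x := y) ≈-refl x y) (≤-+-monoˡ x 0≤y-x))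

-- As a square the product is nonnegative term by term; the terms of `x` and `y` themselves may have
-- opposite signs.
0≤x*y : ∀ {x y} → 0ℝ ≤ x → 0ℝ ≤ y → 0ℝ ≤ x * y
0≤x*y {x} {y} 0≤x 0≤y = ≤-respʳ-≈ (begin
  (√ x * √ y) * (√ x * √ y)
    ≈⟨ solve 2 (λ s t → (s :* t) :* (s :* t) := (s :* s) :* (t :* t)) ≈-refl (√ x) (√ y) ⟩
  (√ x * √ x) * (√ y * √ y)  ≈⟨ *-cong (√*√ x 0≤x) (√*√ y 0≤y) ⟩
  x * y                      ∎)
  (0≤x*x (√ x * √ y))
  where open Sqrt

module _ {y z : ℝ} (0<y : 0ℝ < y) (y≤z : y ≤ z) where

  0<z : 0ℝ < z
  0<z = <-respʳ-≈ (solve 2 (λ y z → y :+ (z :+ :- y) := z) ≈-refl y z) (0<x+y 0<y (x≤y⇒0≤y-x y≤z))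

  -- The expression is z + (z + (z - y)), with z > 0 and z - y ≥ 0.
  0<3z-y : 0ℝ < fromℚ (+ 3 / 1) * z + - y
  0<3z-y = <-respʳ-≈
    (solve 2 (λ y z → z :+ (z :+ (z :+ :- y)) := con (+ 3 / 1) :* z :+ :- y) ≈-refl y z)
    (0<x+y 0<z (<⇒≤ (0<x+y 0<z (x≤y⇒0≤y-x y≤z))))

  -- (z − 3y)(3z − y) = 3(y + z)² − 16yz = 12(a − b)², scaled by 3 to a square.
  realizable⇒3y≤z : LaplacianRealizable (path 3) (0ℝ ∷ y ∷ z ∷ []) → fromℚ (+ 3 / 1) * y ≤ z
  realizable⇒3y≤z (A , L , spec) = 0≤y-x⇒x≤y (0≤x*y⇒0≤x
    (0<x*y (fromℚ-pos (ℚ.positive⁻¹ (+ 3 / 1))) 0<3z-y)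
    (≤-respʳ-≈ (≈-sym factored) (0≤x*x _)))
    where
    a = - A 0F 1F
    b = - A 1F 2F
    y+z : y + z ≈ fromℚ (+ 2 / 1) * (a + b)
    y+z = ≈-trans (≈-sym (proj₁ (hasSpectrum⇒ A spec)))
      (≈-trans (trace-cong (𝒮ᴸ-path₃ L)) (trace-laplacian a b))
    yz : y * z ≈ fromℚ (+ 3 / 1) * (a * b)
    yz = ≈-trans (≈-sym (proj₂ (hasSpectrum⇒ A spec)))
      (≈-trans (principalMinors-cong (𝒮ᴸ-path₃ L)) (principalMinors-laplacian a b))
    factored : (z + - (fromℚ (+ 3 / 1) * y)) * (fromℚ (+ 3 / 1) * (fromℚ (+ 3 / 1) * z + - y))
      ≈ (fromℚ (+ 6 / 1) * (a + - b)) * (fromℚ (+ 6 / 1) * (a + - b))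
    factored = begin
      (z + - (fromℚ (+ 3 / 1) * y)) * (fromℚ (+ 3 / 1) * (fromℚ (+ 3 / 1) * z + - y))
        -- Symmetric in y and z, hence a polynomial in y + z and yz, the two quantities that the
        -- coefficients express through a and b.
        ≈⟨ solve 2 (λ y z →
             (z :+ :- (con (+ 3 / 1) :* y)) :* (con (+ 3 / 1) :* (con (+ 3 / 1) :* z :+ :- y))
             := con (+ 9 / 1) :* ((y :+ z) :* (y :+ z)) :+ :- (con (+ 48 / 1) :* (y :* z)))
             ≈-refl y z ⟩
      fromℚ (+ 9 / 1) * ((y + z) * (y + z)) + - (fromℚ (+ 48 / 1) * (y * z))
        ≈⟨ +-cong (*-congʳ _ (*-cong y+z y+z)) (-‿cong (*-congʳ _ yz)) ⟩
      fromℚ (+ 9 / 1) * ((fromℚ (+ 2 / 1) * (a + b)) * (fromℚ (+ 2 / 1) * (a + b)))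
        + - (fromℚ (+ 48 / 1) * (fromℚ (+ 3 / 1) * (a * b)))
        ≈⟨ solve 2 (λ a b →
             con (+ 9 / 1) :* ((con (+ 2 / 1) :* (a :+ b)) :* (con (+ 2 / 1) :* (a :+ b)))
               :+ :- (con (+ 48 / 1) :* (con (+ 3 / 1) :* (a :* b)))
             := (con (+ 6 / 1) :* (a :+ :- b)) :* (con (+ 6 / 1) :* (a :+ :- b)))
             ≈-refl a b ⟩
      (fromℚ (+ 6 / 1) * (a + - b)) * (fromℚ (+ 6 / 1) * (a + - b)) ∎

  -- The edge weights are the roots of t² − (y + z)/2 t + yz/3.
  3y≤z⇒realizable : fromℚ (+ 3 / 1) * y ≤ z → LaplacianRealizable (path 3) (0ℝ ∷ y ∷ z ∷ [])
  3y≤z⇒realizable 3y≤z = laplacian a b , laplacian-∈𝒮ᴸ 0<a 0<b , hasSpectrum⇐ (laplacian a b)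
    (≈-trans (trace-laplacian a b) (solve 3 (λ y z r →
      con (+ 2 / 1) :* (con (+ 1 / 4) :* (y :+ z) :+ r :+ (con (+ 1 / 4) :* (y :+ z) :+ :- r))
      := y :+ z) ≈-refl y z r))
    (≈-trans (principalMinors-laplacian a b) (≈-trans (*-congʳ _ ab)
      (solve 2 (λ y z → con (+ 3 / 1) :* (con (+ 1 / 3) :* (y :* z)) := y :* z) ≈-refl y z)))
    (determinant-laplacian a b)
    where
    -- A quarter of the discriminant: for s = (y + z)/4 the roots are s ± r with r² = s² - yz/3,
    -- which factors as (z - 3y)(3z - y)/48.
    d = fromℚ (+ 1 / 48) * ((z + - (fromℚ (+ 3 / 1) * y)) * (fromℚ (+ 3 / 1) * z + - y))
    0≤d : 0ℝ ≤ d
    0≤d = 0≤x*y (<⇒≤ (fromℚ-pos (ℚ.positive⁻¹ (+ 1 / 48))))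
      (0≤x*y (x≤y⇒0≤y-x 3y≤z) (<⇒≤ 0<3z-y))
    r = Sqrt.√ d
    a = fromℚ (+ 1 / 4) * (y + z) + r
    b = fromℚ (+ 1 / 4) * (y + z) + - r
    ab : a * b ≈ fromℚ (+ 1 / 3) * (y * z)
    ab = begin
      a * b
        ≈⟨ solve 2 (λ s r → (s :+ r) :* (s :+ :- r) := s :* s :+ :- (r :* r)) ≈-refl _ r ⟩
      (fromℚ (+ 1 / 4) * (y + z)) * (fromℚ (+ 1 / 4) * (y + z)) + - (r * r)
        ≈⟨ +-cong ≈-refl (-‿cong (Sqrt.√*√ d 0≤d)) ⟩
      (fromℚ (+ 1 / 4) * (y + z)) * (fromℚ (+ 1 / 4) * (y + z)) + - d
        ≈⟨ solve 2 (λ y z →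
             (con (+ 1 / 4) :* (y :+ z)) :* (con (+ 1 / 4) :* (y :+ z))
               :+ :- (con (+ 1 / 48)
                 :* ((z :+ :- (con (+ 3 / 1) :* y)) :* (con (+ 3 / 1) :* z :+ :- y)))
             := con (+ 1 / 3) :* (y :* z)) ≈-refl y z ⟩
      fromℚ (+ 1 / 3) * (y * z) ∎
    0<a : 0ℝ < a
    0<a = 0<x+y (0<x*y (fromℚ-pos (ℚ.positive⁻¹ (+ 1 / 4))) (0<x+y 0<y (<⇒≤ 0<z))) (Sqrt.√-nonNeg d)
    -- A difference, so its sign is read off from `a` and the product yz/3.
    0<b : 0ℝ < b
    0<b = 0<x*y⇒0<y 0<a (<-respʳ-≈ (≈-sym ab)
      (0<x*y (fromℚ-pos (ℚ.positive⁻¹ (+ 1 / 3))) (0<x*y 0<y 0<z)))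

proposition2p3 : (λ₂ λ₃ : ℝ) → 0ℝ < λ₂ → λ₂ ≤ λ₃ →
    LaplacianRealizable (path 3) (0ℝ ∷ λ₂ ∷ λ₃ ∷ []) ⇔ λ₃ ≥ fromℚ (+ 3 / 1) * λ₂
proposition2p3 λ₂ λ₃ 0<λ₂ λ₂≤λ₃ =
  mk⇔ (realizable⇒3y≤z 0<λ₂ λ₂≤λ₃) (3y≤z⇒realizable 0<λ₂ λ₂≤λ₃)
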